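{- Let $\phi,\psi:A\to L\{\tau\}$ be two rank $r$ Drinfeld $A$-modules over the finite $A$-field $L$. Then $\phi$ and $\psi$ are isomorphic over $L$ if and only if $J_{k_1\cdots k_l}^{\delta_1\cdots\delta_l}(\phi)=J_{k_1\cdots k_l}^{\delta_1\cdots\delta_l}(\psi)$ for all basic $J$-invariants (i.e. all admissible $(k_1,\dots,k_l)$ and $(\delta_1,\dots,\delta_l)$) and $FI(\phi)=FI(\psi)$. In other words, the $L$-isomorphism classes of Drinfeld modules defined over the finite $A$-field $L$ are determined by their fine isomorphy invariants and $J$-invariants.
   Context: $A=\mathbb{F}_q[T]$; $L$ is a finite $A$-field, i.e. a finite field with an $\mathbb{F}_q$-algebra homomorphism $\gamma:A\to L$. $L\{\tau\}$ is the ring of $\mathbb{F}_q$-linear polynomials over $L$ under composition, where $\tau(x)=x^q$ (so $\tau a=a^q\tau$ for $a\in L$). A Drinfeld $A$-module of rank $r$ over $L$ is an $\mathbb{F}_q$-algebra homomorphism $\phi:A\to L\{\tau\}$, determined by $\phi_T=\gamma(T)+g_1\tau+\cdots+g_r\tau^r$ with $g_i\in L$, $g_r\ne0$. For a field $K\supseteq L$, $\phi$ and $\psi$ are isomorphic over $K$ if there is $x\in K^*$ with $\psi_T=x^{ -1}\phi_Tx$. Basic $J$-invariants: let $1\le k_1<\cdots<k_l\le r-1$ and let $\delta_1,\dots,\delta_l,\delta_r$ be integers such that (a) $\delta_1(q^{k_1}-1)+\cdots+\delta_l(q^{k_l}-1)=\delta_r(q^r-1)$; (b) $0\le\delta_i\le\frac{q^r-1}{q^{\gcd(k_i,r)}-1}$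 for $i=1,\dots,l$; (c) $\gcd(\delta_1,\dots,\delta_l,\delta_r)=1$. Then $J_{k_1\cdots k_l}^{\delta_1\cdots\delta_l}(\phi)=\dfrac{g_{k_1}^{\delta_1}\cdots g_{k_l}^{\delta_l}}{g_r^{\delta_r}}$. Fine isomorphy invariant: put $I=\{i\in\{1,\dots,r\}: g_i\neq0\}$, $d=\gcd(q^k-1: k\in I)$ $(=q^{\delta}-1$ with $\delta=\gcd(k:k\in I))$, and $B=\{\lambda=(\lambda_k)_{k\in I}\in\mathbb{Z}^I: d=\sum_{k\in I}\lambda_k(q^k-1)\}$. For $\lambda\in B$ let $FI_\lambda(\phi)$ be the class of $\prod_{k\in I}g_k^{\lambda_k}$ in $L^*/L^{*d}$, where $L^{*d}$ is the group of $d$-th powers in $L^*$. Then $FI(\phi)=(FI_\lambda(\phi))_{\lambda\in B}$. The equality $FI(\phi)=FI(\psi)$ is equality of families (with the same index set). -}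

module Defs where

open import Algebra.Bundles using (CommutativeRing; RawRing)
open import Algebra.Definitions using (Invertible)
open import Algebra.Morphism.Structures using (module RingMorphisms)
import Algebra.Definitions.RawMonoid as RawMonoidSum
import Algebra.Properties.Semiring.Exp as SemiringExp
open import Data.Bool.Base using (if_then_else_; not)
open import Data.Fin.Base as Fin using (Fin; toℕ)
import Data.Fin.Properties as Fin
open import Data.Fin.Subset using (Subset; _∉_)
open import Data.Integer.Base as ℤ using (ℤ; +_; -[1+_]; 0ℤ; 1ℤ)
import Data.Integer.GCD as ℤ
open import Data.List.Base as List using (List; []; _∷_)
open import Data.Nat.Base as ℕ using (ℕ; zero; suc; _∸_)
import Data.Nat.GCD as ℕ
open import Data.Product.Base using (_×_; ∃; proj₁)
open import Data.Vec.Base as Vec using ()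
open import Data.Vec.Functional as Vector using (Vector)
open import Function.Base using (id)
open import Function.Bundles using (Inverse)
open import Function.Properties.Inverse using (Inverse⇒Injection)
open import Level using (Level; _⊔_) renaming (suc to lsuc)
open import Relation.Binary.Definitions using (Decidable)
open import Relation.Binary.PropositionalEquality.Core using (_≡_)
open import Relation.Binary.PropositionalEquality.Properties using (setoid)
open import Relation.Nullary.Decidable using (does; yes; no; via-injection)
open import Relation.Nullary.Negation using (¬_)

private
  variable
    a ℓ₁ b ℓ₂ : Level

∑ℤ : ∀ {n} → Vector ℤ n → ℤ
∑ℤ = Vector.foldr ℤ._+_ 0ℤ

------------------------------------------------------------------------
-- Finite fields

record FiniteField c ℓ : Set (lsuc (c ⊔ ℓ)) where
  field
    commutativeRing : CommutativeRing c ℓ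

  open CommutativeRing commutativeRing public
    renaming (setoid to ≈-setoid)

  field
    1≉0         : ¬ 1# ≈ 0#
    invertible  : ∀ x → ¬ x ≈ 0# → Invertible _≈_ 1# _*_ x
    size        : ℕ
    enumeration : Inverse ≈-setoid (setoid (Fin size))

  open SemiringExp semiring public using (_^_)
  open RawMonoidSum *-rawMonoid public using () renaming (sum to ∏)

  infix 4 _≟_
  _≟_ : Decidable _≈_
  _≟_ = via-injection (Inverse⇒Injection enumeration) Fin._≟_

  -- The inverse of 0 is set to 0.  Inverses and negative powers are only
  -- ever used below at non-zero elements.
  infix 9 _⁻¹
  _⁻¹ : Carrier → Carrier
  x ⁻¹ with x ≟ 0#
  ... | yes _   = 0#
  ... | no x≉0 = proj₁ (invertible x x≉0)

  infixl 7 _/_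
  _/_ : Carrier → Carrier → Carrier
  x / y = x * y ⁻¹

  infixr 8 _^ℤ_
  _^ℤ_ : Carrier → ℤ → Carrier
  x ^ℤ (+ n)    = x ^ n
  x ^ℤ -[1+ n ] = (x ^ suc n) ⁻¹

  -- For non-zero x and y: x and y have the same class modulo the
  -- subgroup of d-th powers of the multiplicative group.
  SameClassModPowers : ℕ → Carrier → Carrier → Set (c ⊔ ℓ)
  SameClassModPowers d x y = ∃ λ z → ¬ z ≈ 0# × x ≈ z ^ d * y

------------------------------------------------------------------------
-- Skew polynomials  Σ aᵢ Xⁱ  with  X a = σ(a) X.  A polynomial is the
-- list of its coefficients, lowest degree first; lists that differ by
-- trailing zeros are identified by _≈ₚ_.

module SkewPolynomial {c ℓ} (R : CommutativeRing c ℓ)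
                      (σ : CommutativeRing.Carrier R → CommutativeRing.Carrier R)
                      where

  open CommutativeRing R hiding (rawRing)

  Poly : Set c
  Poly = List Carrier

  coeff : Poly → ℕ → Carrier
  coeff []      _       = 0#
  coeff (a ∷ f) zero    = a
  coeff (a ∷ f) (suc n) = coeff f n

  infix 4 _≈ₚ_
  _≈ₚ_ : Poly → Poly → Set ℓ
  f ≈ₚ g = ∀ n → coeff f n ≈ coeff g n

  const : Carrier → Poly
  const a = a ∷ []

  X : Poly
  X = 0# ∷ 1# ∷ []

  infixl 6 _+ₚ_
  _+ₚ_ : Poly → Poly → Poly
  []      +ₚ g       = g
  (a ∷ f) +ₚ []      = a ∷ f
  (a ∷ f) +ₚ (b ∷ g) = (a + b) ∷ (f +ₚ g)

  -- (a + f X) g = a g + (f gᵟ) X, where gᵟ is g with σ applied to its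
  -- coefficients.  Hence the n-th coefficient of f g is Σ_{i+j=n} fᵢ σⁱ(gⱼ).
  infixl 7 _*ₚ_
  _*ₚ_ : Poly → Poly → Poly
  []      *ₚ g = []
  (a ∷ f) *ₚ g = List.map (a *_) g +ₚ (0# ∷ (f *ₚ List.map σ g))

  rawRing : RawRing c ℓ
  rawRing = record
    { Carrier = Poly
    ; _≈_     = _≈ₚ_
    ; _+_     = _+ₚ_
    ; _*_     = _*ₚ_
    ; -_      = List.map (λ a → - a)
    ; 0#      = []
    ; 1#      = const 1#
    }

-- R and S are algebras over a base K by means of s and t.
record IsAlgebraHomomorphism {k} {K : Set k}
    (R : RawRing a ℓ₁) (S : RawRing b ℓ₂)
    (s : K → RawRing.Carrier R) (t : K → RawRing.Carrier S)
    (f : RawRing.Carrier R → RawRing.Carrier S) : Set (k ⊔ a ⊔ ℓ₁ ⊔ ℓ₂) where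
  field
    isRingHomomorphism : RingMorphisms.IsRingHomomorphism R S f
    preserves-scalars  : ∀ x → RawRing._≈_ S (f (s x)) (t x)

-- The polynomial ring A = 𝔽[T].
module 𝔽[T] {c ℓ} (𝔽 : FiniteField c ℓ) where
  open SkewPolynomial (FiniteField.commutativeRing 𝔽) id public
    renaming (X to T)

-- A finite field with an 𝔽-algebra structure ι and an 𝔽-algebra
-- homomorphism γ : A → L.
record FiniteAField {c ℓ} (𝔽 : FiniteField c ℓ) c′ ℓ′ : Set (c ⊔ ℓ ⊔ lsuc (c′ ⊔ ℓ′)) where
  private
    module 𝔽 = FiniteField 𝔽
    module A = 𝔽[T] 𝔽

  field
    finiteField : FiniteField c′ ℓ′

  open FiniteField finiteField public

  field
    ι                   : 𝔽.Carrier → Carrier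
    ι-isRingHomomorphism :
      RingMorphisms.IsRingHomomorphism
        (CommutativeRing.rawRing 𝔽.commutativeRing)
        (CommutativeRing.rawRing commutativeRing) ι
    γ                   : A.Poly → Carrier
    γ-isAlgebraHomomorphism :
      IsAlgebraHomomorphism A.rawRing (CommutativeRing.rawRing commutativeRing)
        A.const ι γ

  q : ℕ
  q = 𝔽.size

  -- L{τ}: the list a₀ ∷ a₁ ∷ … stands for the 𝔽-linear polynomial
  -- Σ aᵢ x^(qⁱ).  Composing a x^(qⁱ) with b x^(qʲ) gives
  -- a b^(qⁱ) x^(qⁱ⁺ʲ), so composition is the skew product for b ↦ b^q.
  module L⟨τ⟩ = SkewPolynomial commutativeRing (_^ q)

------------------------------------------------------------------------
-- Drinfeld modules

module _ {c ℓ c′ ℓ′} {𝔽 : FiniteField c ℓ} (L : FiniteAField 𝔽 c′ ℓ′) where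

  private
    module A = 𝔽[T] 𝔽
  open FiniteAField L

  record DrinfeldModule (r : ℕ) : Set (c ⊔ ℓ ⊔ c′ ⊔ ℓ′) where
    field
      φ                     : A.Poly → L⟨τ⟩.Poly
      φ-isAlgebraHomomorphism :
        IsAlgebraHomomorphism A.rawRing L⟨τ⟩.rawRing
          A.const (λ x → L⟨τ⟩.const (ι x)) φ

    g : ℕ → Carrier
    g = L⟨τ⟩.coeff (φ A.T)

    field
      rank-positive    : 1 ℕ.≤ r
      constant-term    : g 0 ≈ γ A.T
      leading-term     : ¬ g r ≈ 0#
      no-higher-terms  : ∀ k → r ℕ.< k → g k ≈ 0#

module _ {c ℓ c′ ℓ′} {𝔽 : FiniteField c ℓ} {L : FiniteAField 𝔽 c′ ℓ′} {r : ℕ} where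

  private
    module A = 𝔽[T] 𝔽
  open FiniteAField L
  open DrinfeldModule using (φ; g)

  -- Isomorphism over L itself.
  infix 4 _≅_
  _≅_ : DrinfeldModule L r → DrinfeldModule L r → Set (c′ ⊔ ℓ′)
  Φ ≅ Ψ = ∃ λ x → ¬ x ≈ 0# ×
    φ Ψ A.T L⟨τ⟩.≈ₚ (L⟨τ⟩.const (x ⁻¹) L⟨τ⟩.*ₚ φ Φ A.T) L⟨τ⟩.*ₚ L⟨τ⟩.const x

------------------------------------------------------------------------
-- Basic J-invariants

record BasicIndex (q r : ℕ) : Set where
  field
    l            : ℕ
    k            : Fin l → ℕ
    k-lower      : ∀ i → 1 ℕ.≤ k i
    k-increasing : ∀ {i j} → i Fin.< j → k i ℕ.< k j
    k-upper      : ∀ i → k i ℕ.≤ r ∸ 1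
    δ            : Fin l → ℤ
    δᵣ           : ℤ
    weight       : ∑ℤ (λ i → δ i ℤ.* + (q ℕ.^ k i ∸ 1)) ≡ δᵣ ℤ.* + (q ℕ.^ r ∸ 1)
    δ-lower      : ∀ i → 0ℤ ℤ.≤ δ i
    -- δᵢ ≤ (q^r − 1) / (q^gcd(kᵢ,r) − 1), multiplied by the positive denominator.
    δ-upper      : ∀ i → δ i ℤ.* + (q ℕ.^ ℕ.gcd (k i) r ∸ 1) ℤ.≤ + (q ℕ.^ r ∸ 1)
    δ-coprime    : Vector.foldr ℤ.gcd δᵣ δ ≡ 1ℤ

module _ {c ℓ c′ ℓ′} {𝔽 : FiniteField c ℓ} {L : FiniteAField 𝔽 c′ ℓ′} {r : ℕ} where

  open FiniteAField L
  open DrinfeldModule using (g)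

  -- Note 0⁰ = 1, and δᵢ ≥ 0, so gₖ may vanish in the numerator.
  J : BasicIndex q r → DrinfeldModule L r → Carrier
  J β Φ = ∏ (λ i → g Φ (k i) ^ℤ δ i) / g Φ r ^ℤ δᵣ
    where open BasicIndex β

------------------------------------------------------------------------
-- The fine isomorphy invariant.  The element i of Fin r stands for the
-- index suc (toℕ i) of {1,…,r}.

index : ∀ {r} → Fin r → ℕ
index i = suc (toℕ i)

-- gcd (q^k − 1 : k ∈ S); 0 is neutral for gcd.
gcdOver : ℕ → ∀ {r} → Subset r → ℕ
gcdOver q S = Vector.foldr ℕ.gcd 0
  (λ i → if Vec.lookup S i then q ℕ.^ index i ∸ 1 else 0)

-- Elements of ℤ^S are represented by their extension by zero.
record IsBézout (q : ℕ) {r} (S : Subset r) (λs : Fin r → ℤ) : Set where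
  field
    supported : ∀ i → i ∉ S → λs i ≡ 0ℤ
    bézout    : + gcdOver q S ≡ ∑ℤ (λ i → λs i ℤ.* + (q ℕ.^ index i ∸ 1))

module _ {c ℓ c′ ℓ′} {𝔽 : FiniteField c ℓ} {L : FiniteAField 𝔽 c′ ℓ′} {r : ℕ} where

  open FiniteAField L
  open DrinfeldModule using (g)

  I : DrinfeldModule L r → Subset r
  I Φ = Vec.tabulate (λ i → not (does (g Φ (index i) ≟ 0#)))

  -- A representative of FI_λ(Φ).  When λ vanishes outside I(Φ), the
  -- factors outside I(Φ) are 0⁰ = 1 and the product is non-zero.
  FI-representative : (Fin r → ℤ) → DrinfeldModule L r → Carrier
  FI-representative λs Φ = ∏ (λ i → g Φ (index i) ^ℤ λs i)

  -- FI(Φ) = FI(Ψ) as families: same index set, and same class in L*/L*ᵈ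
  -- at every index.
  SameFI : DrinfeldModule L r → DrinfeldModule L r → Set (c′ ⊔ ℓ′)
  SameFI Φ Ψ = I Φ ≡ I Ψ ×
    (∀ λs → IsBézout q (I Φ) λs →
      SameClassModPowers (gcdOver q (I Φ))
        (FI-representative λs Φ) (FI-representative λs Ψ))

{-# OPTIONS --safe #-}
module Submission where

-- Φ ≅ Ψ means that gₖ(Ψ) = x^(q^k − 1) gₖ(Φ) for one x ≠ 0 and all k.  Given
-- equal invariants, let ρₖ = gₖ(Ψ) / gₖ(Φ) for k ∈ I.  Equality of the
-- J-invariants says that ∏ ρₖ^mₖ = 1 for certain integer vectors m with
-- Σ mₖ (q^k − 1) = 0, and in fact this holds for all such m:  modulo the vectors
-- that involve k and r only, with k-th entry (q^r − 1) / (q^gcd(k,r) − 1), the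
-- entries below r can be reduced to satisfy the bounds of a basic J-invariant;
-- a vector within these bounds is, unless it is 0, a multiple of the basic one
-- obtained by dividing by the gcd of its entries, and this also covers the
-- vectors used for the reduction.  Equality of the fine invariants gives
-- ∏ ρₖ^λₖ = x^d for a Bézout vector λ.  Since c λ and the k-th unit vector
-- have the same weight when q^k − 1 = c d, it follows that ρₖ = x^(q^k − 1).

open import Defs
open import Algebra.Bundles using (AbelianGroup; CommutativeMonoid)
import Algebra.Properties.CommutativeMonoid.Sum as CommutativeMonoidSum
import Algebra.Properties.CommutativeSemigroup as CommutativeSemigroupProperties
import Algebra.Properties.CommutativeSemiring.Exp as CommutativeSemiringExp
import Algebra.Properties.Group as GroupProperties
import Algebra.Properties.Semiring.Sum as SemiringSum
open import Data.Bool.Base using (true; false; not; if_then_else_)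
open import Data.Fin.Base using (Fin; zero; suc; toℕ; fromℕ; fromℕ<; inject₁)
import Data.Fin.Properties as Fin
open import Data.Fin.Subset using (Subset; _∈_; _∉_)
open import Data.Integer.Base as ℤ using (ℤ; +_; -[1+_]; 0ℤ)
import Data.Integer.DivMod as ℤ
import Data.Integer.GCD as ℤ
import Data.Integer.Properties as ℤ
import Data.Integer.Tactic.RingSolver as ℤ-Solver
open import Data.List.Base as List using ([]; _∷_)
open import Data.Nat.Base as ℕ using (ℕ; zero; suc; _∸_; NonZero; s≤s; z≤n)
open import Data.Nat.Divisibility using (_∣_; divides; ∣-refl; ∣-trans; 0∣⇒≡0)
import Data.Nat.DivMod as ℕ
import Data.Nat.GCD as ℕ
import Data.Nat.Properties as ℕ
open import Data.Product.Base using (_×_; _,_; ∃; proj₁; proj₂)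
import Data.Vec.Base as Vec
open import Data.Vec.Functional as Vector using ()
import Data.Vec.Properties as Vec
open import Function.Base using (_∘_; case_of_)
open import Function.Bundles using (_⇔_; mk⇔; Equivalence; Injection)
open import Function.Properties.Inverse using (Inverse⇒Injection)
import Relation.Binary.Reasoning.Setoid as SetoidReasoning
open import Relation.Binary.PropositionalEquality.Core as ≡ using (_≡_; _≢_)
open import Relation.Binary.PropositionalEquality.Properties using (module ≡-Reasoning)
open import Relation.Nullary.Decidable using (Dec; yes; no; does; does-⇔; dec-true; dec-false)
open import Relation.Nullary.Negation using (¬_; contradiction)

-- Finite sums in commutative monoids, in particular of integers.

module SumProperties {c ℓ} (M : CommutativeMonoid c ℓ) where
  open CommutativeMonoid M renaming
    ( _∙_ to _+_; ε to 0#; ∙-congˡ to +-congˡ; ∙-cong to +-cong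
    ; identityʳ to +-identityʳ; identityˡ to +-identityˡ )
  open CommutativeMonoidSum M public
  open SetoidReasoning setoid

  sum-zero : ∀ {n} (f : Fin n → Carrier) → (∀ i → f i ≈ 0#) → sum f ≈ 0#
  sum-zero {n} f f≈0 = trans (sum-cong-≋ f≈0) (sum-replicate-zero n)

  sum-single : ∀ {n} (f : Fin n → Carrier) k →
               (∀ i → i ≢ k → f i ≈ 0#) → sum f ≈ f k
  sum-single f zero f≈0 = trans
    (+-congˡ (sum-zero _ (λ i → f≈0 (suc i) λ ())))
    (+-identityʳ _)
  sum-single f (suc k) f≈0 = trans
    (+-cong (f≈0 zero λ ())
            (sum-single (λ i → f (suc i)) k (λ i i≢k → f≈0 (suc i) λ { ≡.refl → i≢k ≡.refl })))
    (+-identityˡ _)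

open SumProperties ℤ.+-0-commutativeMonoid using ()
  renaming (sum-cong-≗ to ∑ℤ-cong; ∑-distrib-+ to ∑ℤ-distrib-+; sum-single to ∑ℤ-single
           ; sum-init-last to ∑ℤ-init-last)
open SemiringSum ℤ.+-*-semiring using ()
  renaming (*-distribˡ-sum to *-distribˡ-∑ℤ; *-distribʳ-sum to *-distribʳ-∑ℤ)
open GroupProperties (AbelianGroup.group ℤ.+-0-abelianGroup) using ()
  renaming (∙-cancelʳ to +ℤ-cancelʳ)

-- Inverses, integer powers and products in a finite field.

module FieldProperties {c ℓ} (K : FiniteField c ℓ) where
  open FiniteField K hiding (zero)
  open SetoidReasoning ≈-setoid
  open CommutativeSemiringExp commutativeSemiring public
    using (^-congˡ; ^-homo-*; ^-assocʳ; ^-distrib-*)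
  open CommutativeSemigroupProperties *-commutativeSemigroup public
    using () renaming (interchange to *-interchange)
  module ∏ = SumProperties *-commutativeMonoid

  ⁻¹-inverseʳ : ∀ {x} → ¬ x ≈ 0# → x * x ⁻¹ ≈ 1#
  ⁻¹-inverseʳ {x} x≉0 with x ≟ 0#
  ... | yes x≈0 = contradiction x≈0 x≉0
  ... | no  x≉0 = proj₂ (proj₂ (invertible x x≉0))

  ⁻¹-inverseˡ : ∀ {x} → ¬ x ≈ 0# → x ⁻¹ * x ≈ 1#
  ⁻¹-inverseˡ x≉0 = trans (*-comm _ _) (⁻¹-inverseʳ x≉0)

  0⁻¹≈0 : ∀ {x} → x ≈ 0# → x ⁻¹ ≈ 0#
  0⁻¹≈0 {x} x≈0 with x ≟ 0#
  ... | yes _   = refl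
  ... | no  x≉0 = contradiction x≈0 x≉0

  *-cancelˡ : ∀ {x y z} → ¬ x ≈ 0# → x * y ≈ x * z → y ≈ z
  *-cancelˡ {x} {y} {z} x≉0 xy≈xz = begin
    y              ≈⟨ *-identityˡ y ⟨
    1# * y         ≈⟨ *-congʳ (⁻¹-inverseˡ x≉0) ⟨
    x ⁻¹ * x * y   ≈⟨ *-assoc _ _ _ ⟩
    x ⁻¹ * (x * y) ≈⟨ *-congˡ xy≈xz ⟩
    x ⁻¹ * (x * z) ≈⟨ *-assoc _ _ _ ⟨
    x ⁻¹ * x * z   ≈⟨ *-congʳ (⁻¹-inverseˡ x≉0) ⟩
    1# * z         ≈⟨ *-identityˡ z ⟩
    z              ∎

  *-cancelʳ : ∀ {x y z} → ¬ x ≈ 0# → y * x ≈ z * x → y ≈ z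
  *-cancelʳ x≉0 yx≈zx =
    *-cancelˡ x≉0 (trans (*-comm _ _) (trans yx≈zx (*-comm _ _)))

  *-≉0 : ∀ {x y} → ¬ x ≈ 0# → ¬ y ≈ 0# → ¬ x * y ≈ 0#
  *-≉0 x≉0 y≉0 xy≈0 = y≉0 (*-cancelˡ x≉0 (trans xy≈0 (sym (zeroʳ _))))

  ⁻¹-≉0 : ∀ {x} → ¬ x ≈ 0# → ¬ x ⁻¹ ≈ 0#
  ⁻¹-≉0 x≉0 x⁻¹≈0 =
    1≉0 (trans (sym (⁻¹-inverseʳ x≉0)) (trans (*-congˡ x⁻¹≈0) (zeroʳ _)))

  ⁻¹-unique : ∀ {x y} → x * y ≈ 1# → y ≈ x ⁻¹
  ⁻¹-unique {x} {y} xy≈1 = *-cancelˡ x≉0 (trans xy≈1 (sym (⁻¹-inverseʳ x≉0)))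
    where
    x≉0 : ¬ x ≈ 0#
    x≉0 x≈0 = 1≉0 (trans (sym xy≈1) (trans (*-congʳ x≈0) (zeroˡ _)))

  -- The value of `x ⁻¹` is the witness stored for the representative x, so congruence rests on the
  -- uniqueness of inverses.
  ⁻¹-cong : ∀ {x y} → x ≈ y → x ⁻¹ ≈ y ⁻¹
  ⁻¹-cong {x} {y} x≈y with x ≟ 0#
  ... | yes x≈0 = sym (0⁻¹≈0 (trans (sym x≈y) x≈0))
  ... | no  x≉0 = ⁻¹-unique (trans (*-congʳ (sym x≈y)) (proj₂ (proj₂ (invertible x x≉0))))

  1⁻¹≈1 : 1# ⁻¹ ≈ 1#
  1⁻¹≈1 = sym (⁻¹-unique (*-identityˡ 1#))

  -- The convention that 0 has inverse 0 covers the cases with a zero factor, so negative powers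
  -- split over products even where some gₖ vanishes.
  ⁻¹-distrib-* : ∀ x y → (x * y) ⁻¹ ≈ x ⁻¹ * y ⁻¹
  ⁻¹-distrib-* x y with x ≟ 0# | y ≟ 0#
  ... | yes x≈0 | _ = trans (0⁻¹≈0 (trans (*-congʳ x≈0) (zeroˡ y))) (sym (zeroˡ _))
  ... | no _ | yes y≈0 = trans (0⁻¹≈0 (trans (*-congˡ y≈0) (zeroʳ x))) (sym (zeroʳ _))
  ... | no x≉0 | no y≉0 = sym (⁻¹-unique (begin
    x * y * (proj₁ (invertible x x≉0) * proj₁ (invertible y y≉0))
      ≈⟨ *-interchange x y _ _ ⟩
    x * proj₁ (invertible x x≉0) * (y * proj₁ (invertible y y≉0))
      ≈⟨ *-cong (proj₂ (proj₂ (invertible x x≉0))) (proj₂ (proj₂ (invertible y y≉0))) ⟩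
    1# * 1#
      ≈⟨ *-identityˡ 1# ⟩
    1# ∎))

  /-cancelʳ : ∀ {x y} → ¬ y ≈ 0# → x / y * y ≈ x
  /-cancelʳ {x} {y} y≉0 = begin
    x * y ⁻¹ * y   ≈⟨ *-assoc _ _ _ ⟩
    x * (y ⁻¹ * y) ≈⟨ *-congˡ (⁻¹-inverseˡ y≉0) ⟩
    x * 1#         ≈⟨ *-identityʳ x ⟩
    x              ∎

  ^-≉0 : ∀ {x} → ¬ x ≈ 0# → ∀ n → ¬ x ^ n ≈ 0#
  ^-≉0 x≉0 zero    = 1≉0
  ^-≉0 x≉0 (suc n) = *-≉0 x≉0 (^-≉0 x≉0 n)

  ^ℤ-≉0 : ∀ {x} → ¬ x ≈ 0# → ∀ m → ¬ x ^ℤ m ≈ 0#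
  ^ℤ-≉0 x≉0 (+ n)    = ^-≉0 x≉0 n
  ^ℤ-≉0 x≉0 -[1+ n ] = ⁻¹-≉0 (^-≉0 x≉0 (suc n))

  ^ℤ-congˡ : ∀ {x y} m → x ≈ y → x ^ℤ m ≈ y ^ℤ m
  ^ℤ-congˡ (+ n)    x≈y = ^-congˡ n x≈y
  ^ℤ-congˡ -[1+ n ] x≈y = ⁻¹-cong (^-congˡ (suc n) x≈y)

  -- This serves natural exponents as well: `x ^ℤ (+ n)` computes to `x ^ n`, and an equation of
  -- naturals enters through `≡.cong +_`.
  ^ℤ-congʳ : ∀ x {m n} → m ≡ n → x ^ℤ m ≈ x ^ℤ n
  ^ℤ-congʳ x ≡.refl = refl

  ^ℤ-distrib-* : ∀ x y m → (x * y) ^ℤ m ≈ x ^ℤ m * y ^ℤ m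
  ^ℤ-distrib-* x y (+ n)    = ^-distrib-* x y n
  ^ℤ-distrib-* x y -[1+ n ] =
    trans (⁻¹-cong (^-distrib-* x y (suc n))) (⁻¹-distrib-* _ _)

  1^n≈1 : ∀ n → 1# ^ n ≈ 1#
  1^n≈1 zero    = refl
  1^n≈1 (suc n) = trans (*-identityˡ _) (1^n≈1 n)

  1^ℤm≈1 : ∀ m → 1# ^ℤ m ≈ 1#
  1^ℤm≈1 (+ n)    = 1^n≈1 n
  1^ℤm≈1 -[1+ n ] = trans (⁻¹-cong (1^n≈1 (suc n))) 1⁻¹≈1

  module _ {x} (x≉0 : ¬ x ≈ 0#) where

    -- The sum of two integers of opposite sign computes to a `⊖`, so this settles the mixed cases
    -- of `^ℤ-homo-*`.
    ^ℤ-⊖ : ∀ m n → x ^ℤ (m ℤ.⊖ n) ≈ x ^ m / x ^ n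
    ^ℤ-⊖ zero    zero    = sym (⁻¹-inverseʳ 1≉0)
    ^ℤ-⊖ (suc m) zero    = sym (trans (*-congˡ 1⁻¹≈1) (*-identityʳ _))
    ^ℤ-⊖ zero    (suc n) = sym (*-identityˡ _)
    ^ℤ-⊖ (suc m) (suc n) = begin
      x ^ℤ (suc m ℤ.⊖ suc n)         ≈⟨ ^ℤ-congʳ x (ℤ.[1+m]⊖[1+n]≡m⊖n m n) ⟩
      x ^ℤ (m ℤ.⊖ n)                 ≈⟨ ^ℤ-⊖ m n ⟩
      x ^ m / x ^ n                  ≈⟨ *-identityˡ _ ⟨
      1# * (x ^ m / x ^ n)           ≈⟨ *-congʳ (⁻¹-inverseʳ x≉0) ⟨
      x * x ⁻¹ * (x ^ m / x ^ n)     ≈⟨ *-interchange _ _ _ _ ⟩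
      x * x ^ m * (x ⁻¹ * (x ^ n) ⁻¹) ≈⟨ *-congˡ (⁻¹-distrib-* _ _) ⟨
      x ^ suc m / x ^ suc n          ∎

    ^ℤ-homo-* : ∀ m n → x ^ℤ (m ℤ.+ n) ≈ x ^ℤ m * x ^ℤ n
    ^ℤ-homo-* (+ m)    (+ n)    = ^-homo-* x m n
    ^ℤ-homo-* (+ m)    -[1+ n ] = ^ℤ-⊖ m (suc n)
    ^ℤ-homo-* -[1+ m ] (+ n)    = trans (^ℤ-⊖ n (suc m)) (*-comm _ _)
    ^ℤ-homo-* -[1+ m ] -[1+ n ] = begin
      (x ^ suc (suc (m ℕ.+ n))) ⁻¹      ≡⟨ ≡.cong (λ k → (x ^ suc k) ⁻¹) (ℕ.+-suc m n) ⟨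
      (x ^ (suc m ℕ.+ suc n)) ⁻¹        ≈⟨ ⁻¹-cong (^-homo-* x (suc m) (suc n)) ⟩
      (x ^ suc m * x ^ suc n) ⁻¹        ≈⟨ ⁻¹-distrib-* _ _ ⟩
      (x ^ suc m) ⁻¹ * (x ^ suc n) ⁻¹   ∎

    ^ℤ-neg : ∀ m → x ^ℤ (ℤ.- m) ≈ (x ^ℤ m) ⁻¹
    ^ℤ-neg m = ⁻¹-unique (begin
      x ^ℤ m * x ^ℤ (ℤ.- m) ≈⟨ ^ℤ-homo-* m (ℤ.- m) ⟨
      x ^ℤ (m ℤ.+ ℤ.- m)    ≈⟨ ^ℤ-congʳ x (ℤ.+-inverseʳ m) ⟩
      1#                    ∎)

    ^ℤ-assoc-+ : ∀ m n → (x ^ℤ m) ^ n ≈ x ^ℤ (m ℤ.* + n)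
    ^ℤ-assoc-+ m zero    = ^ℤ-congʳ x (≡.sym (ℤ.*-zeroʳ m))
    ^ℤ-assoc-+ m (suc n) = begin
      x ^ℤ m * (x ^ℤ m) ^ n        ≈⟨ *-congˡ (^ℤ-assoc-+ m n) ⟩
      x ^ℤ m * x ^ℤ (m ℤ.* + n)    ≈⟨ ^ℤ-homo-* m _ ⟨
      x ^ℤ (m ℤ.+ m ℤ.* + n)       ≈⟨ ^ℤ-congʳ x (ℤ.*-suc m (+ n)) ⟨
      x ^ℤ (m ℤ.* + suc n)         ∎

    ^ℤ-assoc : ∀ m n → (x ^ℤ m) ^ℤ n ≈ x ^ℤ (m ℤ.* n)
    ^ℤ-assoc m (+ n)    = ^ℤ-assoc-+ m n
    ^ℤ-assoc m -[1+ n ] = begin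
      ((x ^ℤ m) ^ suc n) ⁻¹        ≈⟨ ⁻¹-cong (^ℤ-assoc-+ m (suc n)) ⟩
      (x ^ℤ (m ℤ.* + suc n)) ⁻¹    ≈⟨ ^ℤ-neg (m ℤ.* + suc n) ⟨
      x ^ℤ (ℤ.- (m ℤ.* + suc n))   ≈⟨ ^ℤ-congʳ x (ℤ.neg-distribʳ-* m (+ suc n)) ⟩
      x ^ℤ (m ℤ.* -[1+ n ])        ∎

    ∏-^ℤ : ∀ {n} (m : Fin n → ℤ) → ∏ (λ i → x ^ℤ m i) ≈ x ^ℤ ∑ℤ m
    ∏-^ℤ {zero}  m = refl
    ∏-^ℤ {suc n} m =
      trans (*-congˡ (∏-^ℤ (λ i → m (suc i)))) (sym (^ℤ-homo-* (m zero) _))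

  ∏-≉0 : ∀ {n} (f : Fin n → Carrier) → (∀ i → ¬ f i ≈ 0#) → ¬ ∏ f ≈ 0#
  ∏-≉0 {zero}  f f≉0 = 1≉0
  ∏-≉0 {suc n} f f≉0 = *-≉0 (f≉0 zero) (∏-≉0 _ (λ i → f≉0 (suc i)))

  ^ℤ-distrib-∏ : ∀ {n} (f : Fin n → Carrier) m → ∏ f ^ℤ m ≈ ∏ (λ i → f i ^ℤ m)
  ^ℤ-distrib-∏ {zero}  f m = 1^ℤm≈1 m
  ^ℤ-distrib-∏ {suc n} f m =
    trans (^ℤ-distrib-* _ _ m) (*-congˡ (^ℤ-distrib-∏ (λ i → f (suc i)) m))

-- Divisibility of q^n - 1, gcds of finite families and Bézout's identity.

[1+y]^n≡1+t*y : ∀ y n → ∃ λ t → suc y ℕ.^ n ≡ suc (t ℕ.* y)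
[1+y]^n≡1+t*y y zero    = 0 , ≡.refl
[1+y]^n≡1+t*y y (suc n) with t , eq ← [1+y]^n≡1+t*y y n =
  -- The witness comes from (1 + y)(1 + t y) = 1 + (1 + (1 + y) t) y.
  suc (suc y ℕ.* t) , (begin
    suc y ℕ.* suc y ℕ.^ n             ≡⟨ ≡.cong (suc y ℕ.*_) eq ⟩
    suc y ℕ.* suc (t ℕ.* y)           ≡⟨ ℕ.*-suc (suc y) (t ℕ.* y) ⟩
    suc y ℕ.+ suc y ℕ.* (t ℕ.* y)     ≡⟨ ≡.cong (suc y ℕ.+_) (ℕ.*-assoc (suc y) t y) ⟨
    suc (suc (suc y ℕ.* t) ℕ.* y)     ∎)
  where open ≡-Reasoning

y∣[1+y]^n∸1 : ∀ y n → y ∣ suc y ℕ.^ n ∸ 1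
y∣[1+y]^n∸1 y n with t , eq ← [1+y]^n≡1+t*y y n = divides t (≡.cong (_∸ 1) eq)

-- Put 1 + y = q^d in the preceding divisibility; q ≠ 0 makes `q ℕ.^ d ∸ 1` a true predecessor.
q^d∸1∣q^n∸1 : ∀ q .{{_ : NonZero q}} {d n} → d ∣ n → q ℕ.^ d ∸ 1 ∣ q ℕ.^ n ∸ 1
q^d∸1∣q^n∸1 q {d} (divides t ≡.refl) =
  ≡.subst (q ℕ.^ d ∸ 1 ∣_) (≡.cong (_∸ 1) eq) (y∣[1+y]^n∸1 (q ℕ.^ d ∸ 1) t)
  where
  open ≡-Reasoning
  eq : suc (q ℕ.^ d ∸ 1) ℕ.^ t ≡ q ℕ.^ (t ℕ.* d)
  eq = begin
    suc (q ℕ.^ d ∸ 1) ℕ.^ t ≡⟨ ≡.cong (ℕ._^ t) (ℕ.m+[n∸m]≡n (ℕ.m^n>0 q d)) ⟩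
    (q ℕ.^ d) ℕ.^ t         ≡⟨ ℕ.^-*-assoc q d t ⟩
    q ℕ.^ (d ℕ.* t)         ≡⟨ ≡.cong (q ℕ.^_) (ℕ.*-comm d t) ⟩
    q ℕ.^ (t ℕ.* d)         ∎

-- The base 0 gives `gcdOver`; the base δᵣ gives the gcd in the coprimality condition (c).
gcdFold : ∀ {n} → ℕ → (Fin n → ℕ) → ℕ
gcdFold e a = Vector.foldr ℕ.gcd e a

gcdFold∣base : ∀ {n} e (a : Fin n → ℕ) → gcdFold e a ∣ e
gcdFold∣base {zero}  e a = ∣-refl
gcdFold∣base {suc n} e a = ∣-trans (ℕ.gcd[m,n]∣n (a zero) _) (gcdFold∣base e (a ∘ suc))

gcdFold∣ : ∀ {n} e (a : Fin n → ℕ) i → gcdFold e a ∣ a i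
gcdFold∣ e a zero    = ℕ.gcd[m,n]∣m (a zero) _
gcdFold∣ e a (suc i) = ∣-trans (ℕ.gcd[m,n]∣n (a zero) _) (gcdFold∣ e (a ∘ suc) i)

gcdFold-cong : ∀ {n e e′} {a a′ : Fin n → ℕ} → e ≡ e′ → (∀ i → a i ≡ a′ i) →
               gcdFold e a ≡ gcdFold e′ a′
gcdFold-cong {zero}  e≡e′ _    = e≡e′
gcdFold-cong {suc n} e≡e′ a≡a′ = ≡.cong₂ ℕ.gcd (a≡a′ zero) (gcdFold-cong e≡e′ (a≡a′ ∘ suc))

gcdFold-*ˡ : ∀ {n} g e (a : Fin n → ℕ) →
             gcdFold (g ℕ.* e) (λ i → g ℕ.* a i) ≡ g ℕ.* gcdFold e a
gcdFold-*ˡ {zero}  g e a = ≡.refl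
gcdFold-*ˡ {suc n} g e a = ≡.trans
  (≡.cong (ℕ.gcd (g ℕ.* a zero)) (gcdFold-*ˡ g e (a ∘ suc)))
  (≡.sym (ℕ.c*gcd[m,n]≡gcd[cm,cn] g (a zero) _))

-- Multiplying the quotients by g restores the family with gcd g, and g ≠ 0 can be cancelled.
gcdFold-quotient : ∀ {n g e e′} {a a′ : Fin n → ℕ} .{{_ : NonZero g}} → gcdFold e a ≡ g →
                   e ≡ e′ ℕ.* g → (∀ i → a i ≡ a′ i ℕ.* g) → gcdFold e′ a′ ≡ 1
gcdFold-quotient {g = g} {e} {e′} {a} {a′} gcd≡g e≡ a≡ = ℕ.*-cancelˡ-≡ _ 1 g (begin
  g ℕ.* gcdFold e′ a′                         ≡⟨ gcdFold-*ˡ g e′ a′ ⟨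
  gcdFold (g ℕ.* e′) (λ i → g ℕ.* a′ i)       ≡⟨ gcdFold-cong (≡.trans (ℕ.*-comm g e′) (≡.sym e≡))
                                                  (λ i → ≡.trans (ℕ.*-comm g (a′ i)) (≡.sym (a≡ i))) ⟩
  gcdFold e a                                 ≡⟨ gcd≡g ⟩
  g                                           ≡⟨ ℕ.*-identityʳ g ⟨
  g ℕ.* 1                                     ∎)
  where open ≡-Reasoning

foldr-gcd-+ : ∀ {n} e (a : Fin n → ℕ) → Vector.foldr ℤ.gcd (+ e) (λ i → + a i) ≡ + gcdFold e a
foldr-gcd-+ {zero}  e a = ≡.refl
foldr-gcd-+ {suc n} e a = ≡.cong (ℤ.gcd (+ a zero)) (foldr-gcd-+ e (a ∘ suc))

-- `ℕ.Bézout.identity` has natural coefficients and two shapes, d + y n = x m and d + x m = y n;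
-- each becomes a signed combination.
gcd-bézout : ∀ m n → ∃ λ x → ∃ λ y → + ℕ.gcd m n ≡ x ℤ.* + m ℤ.+ y ℤ.* + n
gcd-bézout m n with ℕ.Bézout.identity (ℕ.gcd-GCD m n)
... | ℕ.Bézout.+- x y eq = + x , ℤ.- + y , (begin
  + ℕ.gcd m n                              ≡⟨ ring (+ ℕ.gcd m n) (+ y ℤ.* + n) ⟩
  + ℕ.gcd m n ℤ.+ + y ℤ.* + n ℤ.- + y ℤ.* + n
    ≡⟨ ≡.cong (ℤ._- + y ℤ.* + n) (≡.cong (λ z → + ℕ.gcd m n ℤ.+ z) (ℤ.pos-* y n)) ⟨
  + (ℕ.gcd m n ℕ.+ y ℕ.* n) ℤ.- + y ℤ.* + n  ≡⟨ ≡.cong (λ z → + z ℤ.- + y ℤ.* + n) eq ⟩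
  + (x ℕ.* m) ℤ.- + y ℤ.* + n               ≡⟨ ≡.cong (ℤ._- + y ℤ.* + n) (ℤ.pos-* x m) ⟩
  + x ℤ.* + m ℤ.- + y ℤ.* + n
    ≡⟨ ≡.cong (λ z → + x ℤ.* + m ℤ.+ z) (ℤ.neg-distribˡ-* (+ y) (+ n)) ⟩
  + x ℤ.* + m ℤ.+ ℤ.- + y ℤ.* + n           ∎)
  where
  open ≡-Reasoning
  ring : ∀ i j → i ≡ i ℤ.+ j ℤ.- j
  ring = ℤ-Solver.solve-∀
... | ℕ.Bézout.-+ x y eq = ℤ.- + x , + y , (begin
  + ℕ.gcd m n                              ≡⟨ ring (+ ℕ.gcd m n) (+ x ℤ.* + m) ⟩
  ℤ.- (+ x ℤ.* + m) ℤ.+ (+ ℕ.gcd m n ℤ.+ + x ℤ.* + m)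
    ≡⟨ ≡.cong (λ z → ℤ.- (+ x ℤ.* + m) ℤ.+ (+ ℕ.gcd m n ℤ.+ z)) (ℤ.pos-* x m) ⟨
  ℤ.- (+ x ℤ.* + m) ℤ.+ + (ℕ.gcd m n ℕ.+ x ℕ.* m)  ≡⟨ ≡.cong (λ z → ℤ.- (+ x ℤ.* + m) ℤ.+ + z) eq ⟩
  ℤ.- (+ x ℤ.* + m) ℤ.+ + (y ℕ.* n)
    ≡⟨ ≡.cong₂ ℤ._+_ (ℤ.neg-distribˡ-* (+ x) (+ m)) (ℤ.pos-* y n) ⟩
  ℤ.- + x ℤ.* + m ℤ.+ + y ℤ.* + n           ∎)
  where
  open ≡-Reasoning
  ring : ∀ i j → i ≡ ℤ.- j ℤ.+ (i ℤ.+ j)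
  ring = ℤ-Solver.solve-∀

gcdFold-bézout : ∀ {n} (w : Fin n → ℕ) →
                 ∃ λ (x : Fin n → ℤ) → + gcdFold 0 w ≡ ∑ℤ (λ i → x i ℤ.* + w i)
gcdFold-bézout {zero}  w = (λ ()) , ≡.refl
gcdFold-bézout {suc n} w
  with x , x-bézout ← gcdFold-bézout (w ∘ suc)
  with y , z , gcd≡ ← gcd-bézout (w zero) (gcdFold 0 (w ∘ suc)) =
  y Vector.∷ (λ i → z ℤ.* x i) , (begin
    + ℕ.gcd (w zero) (gcdFold 0 (w ∘ suc))                 ≡⟨ gcd≡ ⟩
    y ℤ.* + w zero ℤ.+ z ℤ.* + gcdFold 0 (w ∘ suc)
      ≡⟨ ≡.cong (λ k → y ℤ.* + w zero ℤ.+ z ℤ.* k) x-bézout ⟩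
    y ℤ.* + w zero ℤ.+ z ℤ.* ∑ℤ (λ i → x i ℤ.* + w (suc i))
      ≡⟨ ≡.cong (λ k → y ℤ.* + w zero ℤ.+ k) (*-distribˡ-∑ℤ z (λ i → x i ℤ.* + w (suc i))) ⟩
    y ℤ.* + w zero ℤ.+ ∑ℤ (λ i → z ℤ.* (x i ℤ.* + w (suc i)))
      ≡⟨ ≡.cong (λ k → y ℤ.* + w zero ℤ.+ k) (∑ℤ-cong (λ i → ≡.sym (ℤ.*-assoc z (x i) _))) ⟩
    y ℤ.* + w zero ℤ.+ ∑ℤ (λ i → z ℤ.* x i ℤ.* + w (suc i)) ∎)
  where open ≡-Reasoning

-- Weights of integer vectors and multiples of unit vectors.

∑ℤ-nonneg : ∀ {n} (f : Fin n → ℤ) → (∀ i → 0ℤ ℤ.≤ f i) → 0ℤ ℤ.≤ ∑ℤ f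
∑ℤ-nonneg {zero}  f 0≤f = ℤ.≤-refl
∑ℤ-nonneg {suc n} f 0≤f = ℤ.+-mono-≤ (0≤f zero) (∑ℤ-nonneg (f ∘ suc) (0≤f ∘ suc))

-- As an exponent vector, x = M k gives the relation between the indices k and r alone, and x = 1
-- isolates a single ρₖ.
single : ∀ {n} → Fin n → ℕ → Fin n → ℕ
single k x i with i Fin.≟ k
... | yes _ = x
... | no  _ = 0

single-≡ : ∀ {n} (k : Fin n) x → single k x k ≡ x
single-≡ k x with k Fin.≟ k
... | yes _   = ≡.refl
... | no  k≢k = contradiction ≡.refl k≢k

single-≢ : ∀ {n} (k : Fin n) x i → i ≢ k → single k x i ≡ 0
single-≢ k x i i≢k with i Fin.≟ k
... | yes i≡k = contradiction i≡k i≢k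
... | no  _   = ≡.refl

∑ℤ-single-* : ∀ {n} k x (w : Fin n → ℕ) →
              ∑ℤ (λ i → + single k x i ℤ.* + w i) ≡ + x ℤ.* + w k
∑ℤ-single-* k x w = ≡.trans
  (∑ℤ-single (λ i → + single k x i ℤ.* + w i) k
    (λ i i≢k → ≡.cong (λ z → + z ℤ.* + w i) (single-≢ k x i i≢k)))
  (≡.cong (λ z → + z ℤ.* + w k) (single-≡ k x))

-- Multiplicative relations generated by those of the basic J-invariants.

-- Conditions (a) and (b) on a basic J-invariant, with w i = q^kᵢ − 1,
-- D i = q^gcd(kᵢ,r) − 1 and N = q^r − 1.
record Admissible {n} (w D : Fin n → ℕ) (N : ℕ) (a : Fin n → ℕ) (e : ℕ) : Set where
  field
    weight : ∑ℤ (λ i → + a i ℤ.* + w i) ≡ + e ℤ.* + N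
    upper  : ∀ i → a i ℕ.* D i ℕ.≤ N

module _ {c ℓ} (K : FiniteField c ℓ) where
  open FiniteField K hiding (zero; ring)
  open FieldProperties K

  -- In the application, u and v are the ratios ρₖ for k < r and for k = r, and `Off i` says that
  -- the coefficient at the i-th index vanishes. J-invariants give relations only for vectors that
  -- are 0 at such indices.
  module Generation {n} (w D : Fin n → ℕ) (N : ℕ) .{{_ : NonZero N}}
    (D∣w : ∀ i → D i ∣ w i) (D∣N : ∀ i → D i ∣ N)
    (u : Fin n → Carrier) (u≉0 : ∀ i → ¬ u i ≈ 0#)
    (v : Carrier) (v≉0 : ¬ v ≈ 0#)
    {p} {Off : Fin n → Set p} (off? : ∀ i → Dec (Off i))
    (primitive-relation : ∀ a e → Admissible w D N a e → gcdFold e a ≡ 1 →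
                          (∀ i → Off i → a i ≡ 0) → ∏ (λ i → u i ^ a i) ≈ v ^ e)
    where

    -- Condition (a) is homogeneous and (b) survives a decrease of the entries, so the gcd g of all
    -- entries can be divided out; the g-th power of the primitive relation is the one wanted.
    admissible : ∀ a e → Admissible w D N a e → (∀ i → Off i → a i ≡ 0) →
                 ∏ (λ i → u i ^ a i) ≈ v ^ e
    admissible a e adm off with gcdFold e a in gcd≡
    -- A gcd of 0 forces all entries and e to be 0, and both sides are 1.
    ... | zero = begin
      ∏ (λ i → u i ^ a i)
        ≈⟨ ∏.sum-zero _ (λ i → ^ℤ-congʳ (u i) (≡.cong +_ (0∣⇒≡0 (≡.subst (_∣ a i) gcd≡ (gcdFold∣ e a i))))) ⟩
      1#
        ≈⟨ ^ℤ-congʳ v (≡.cong +_ (≡.sym (0∣⇒≡0 (≡.subst (_∣ e) gcd≡ (gcdFold∣base e a))))) ⟩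
      v ^ e               ∎
      where open SetoidReasoning ≈-setoid
    ... | g@(suc _) = let open SetoidReasoning ≈-setoid in begin
      ∏ (λ i → u i ^ a i)          ≈⟨ ∏.sum-cong-≋ (λ i → ^ℤ-congʳ (u i) (≡.cong +_ (a≡ i))) ⟩
      ∏ (λ i → u i ^ (a′ i ℕ.* g)) ≈⟨ ∏.sum-cong-≋ (λ i → ^-assocʳ (u i) (a′ i) g) ⟨
      ∏ (λ i → (u i ^ a′ i) ^ g)   ≈⟨ ^ℤ-distrib-∏ (λ i → u i ^ a′ i) (+ g) ⟨
      ∏ (λ i → u i ^ a′ i) ^ g
        ≈⟨ ^-congˡ g (primitive-relation a′ e′ adm′ (gcdFold-quotient gcd≡ e≡ a≡) off′) ⟩
      (v ^ e′) ^ g                 ≈⟨ ^-assocʳ v e′ g ⟩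
      v ^ (e′ ℕ.* g)               ≈⟨ ^ℤ-congʳ v (≡.cong +_ e≡) ⟨
      v ^ e                        ∎
      where
      open Admissible adm
      a∣ : ∀ i → g ∣ a i
      a∣ i = ≡.subst (_∣ a i) gcd≡ (gcdFold∣ e a i)
      a′ : Fin n → ℕ
      a′ i = _∣_.quotient (a∣ i)
      a≡ : ∀ i → a i ≡ a′ i ℕ.* g
      a≡ i = _∣_.equality (a∣ i)
      e∣ : g ∣ e
      e∣ = ≡.subst (_∣ e) gcd≡ (gcdFold∣base e a)
      e′ : ℕ
      e′ = _∣_.quotient e∣
      e≡ : e ≡ e′ ℕ.* g
      e≡ = _∣_.equality e∣
      off′ : ∀ i → Off i → a′ i ≡ 0
      off′ i o = ℕ.m*n≡0⇒m≡0 (a′ i) g (≡.trans (≡.sym (a≡ i)) (off i o))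
      ring : ∀ x y z → x ℤ.* (y ℤ.* z) ≡ y ℤ.* x ℤ.* z
      ring = ℤ-Solver.solve-∀
      adm′ : Admissible w D N a′ e′
      adm′ = record
        { weight = ℤ.*-cancelˡ-≡ (+ g) _ _ (let open ≡-Reasoning in begin
            + g ℤ.* ∑ℤ (λ i → + a′ i ℤ.* + w i)   ≡⟨ *-distribˡ-∑ℤ (+ g) (λ i → + a′ i ℤ.* + w i) ⟩
            ∑ℤ (λ i → + g ℤ.* (+ a′ i ℤ.* + w i)) ≡⟨ ∑ℤ-cong (λ i → ≡.trans (ring (+ g) (+ a′ i) (+ w i))
                                                       (≡.cong (ℤ._* + w i) (≡.trans (≡.sym (ℤ.pos-* (a′ i) g)) (≡.cong +_ (≡.sym (a≡ i)))))) ⟩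
            ∑ℤ (λ i → + a i ℤ.* + w i)            ≡⟨ weight ⟩
            + e ℤ.* + N
              ≡⟨ ≡.cong (ℤ._* + N) (≡.trans (≡.cong +_ e≡) (ℤ.pos-* e′ g)) ⟩
            + e′ ℤ.* + g ℤ.* + N                  ≡⟨ ring (+ g) (+ e′) (+ N) ⟨
            + g ℤ.* (+ e′ ℤ.* + N)                ∎)
        ; upper = λ i → ℕ.≤-trans (ℕ.*-monoˡ-≤ (D i) (≡.subst (a′ i ℕ.≤_) (≡.sym (a≡ i)) (ℕ.m≤m*n (a′ i) g))) (upper i)
        }

    -- M i is the bound (q^r - 1) / (q^gcd(kᵢ,r) - 1) of condition (b), and C i is the exponent of v
    -- that balances it in (a).
    M C : Fin n → ℕ
    M i = _∣_.quotient (D∣N i)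
    C i = _∣_.quotient (D∣w i)

    N≡M*D : ∀ i → N ≡ M i ℕ.* D i
    N≡M*D i = _∣_.equality (D∣N i)

    M*w≡C*N : ∀ i → + M i ℤ.* + w i ≡ + C i ℤ.* + N
    M*w≡C*N i = begin
      + M i ℤ.* + w i
        ≡⟨ ≡.cong (λ z → + M i ℤ.* z) (≡.trans (≡.cong +_ (_∣_.equality (D∣w i))) (ℤ.pos-* (C i) (D i))) ⟩
      + M i ℤ.* (+ C i ℤ.* + D i)    ≡⟨ ring (+ M i) (+ C i) (+ D i) ⟩
      + C i ℤ.* (+ M i ℤ.* + D i)
        ≡⟨ ≡.cong (λ z → + C i ℤ.* z) (≡.trans (≡.cong +_ (N≡M*D i)) (ℤ.pos-* (M i) (D i))) ⟨
      + C i ℤ.* + N                  ∎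
      where
      open ≡-Reasoning
      ring : ∀ x y z → x ℤ.* (y ℤ.* z) ≡ y ℤ.* (x ℤ.* z)
      ring = ℤ-Solver.solve-∀

    -- The vector with the single entry M k attains the bound (b), hence is itself admissible.
    u^M≈v^C : ∀ k → ¬ Off k → u k ^ M k ≈ v ^ C k
    u^M≈v^C k on = begin
      u k ^ M k                       ≈⟨ ^ℤ-congʳ (u k) (≡.cong +_ (single-≡ k (M k))) ⟨
      u k ^ single k (M k) k
        ≈⟨ ∏.sum-single _ k (λ i i≢k → ^ℤ-congʳ (u i) (≡.cong +_ (single-≢ k (M k) i i≢k))) ⟨
      ∏ (λ i → u i ^ single k (M k) i) ≈⟨ admissible (single k (M k)) (C k) adm off ⟩
      v ^ C k                         ∎
      where
      open SetoidReasoning ≈-setoid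
      off : ∀ i → Off i → single k (M k) i ≡ 0
      off i o = single-≢ k (M k) i λ { ≡.refl → on o }
      upper : ∀ i → single k (M k) i ℕ.* D i ℕ.≤ N
      upper i with i Fin.≟ k
      ... | yes ≡.refl = ℕ.≤-reflexive (≡.sym (N≡M*D k))
      ... | no  _      = ℕ.z≤n
      adm : Admissible w D N (single k (M k)) (C k)
      adm = record
        { weight = ≡.trans (∑ℤ-single-* k (M k) w) (M*w≡C*N k)
        ; upper  = upper
        }

    instance
      M-nonZero : ∀ {i} → NonZero (M i)
      M-nonZero {i} = ℕ.m*n≢0⇒m≢0 (M i) {{≡.subst NonZero (N≡M*D i) it}}
        where
        -- The instance of the module is irrelevant; a relevant one is rebuilt from 0 < N.
        it : NonZero N
        it = ℕ.>-nonZero (ℕ.>-nonZero⁻¹ N)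

    -- Divide each m i by M i, with quotient t i and remainder a i. By `u^M≈v^C` the quotient parts
    -- contribute v^T; the remainders satisfy (b) and have weight (e - T) N, so `admissible` applies
    -- to them.
    generation : ∀ (m : Fin n → ℤ) e → ∑ℤ (λ i → m i ℤ.* + w i) ≡ e ℤ.* + N →
                 (∀ i → Off i → m i ≡ 0ℤ) → ∏ (λ i → u i ^ℤ m i) ≈ v ^ℤ e
    generation m e weight off = let open SetoidReasoning ≈-setoid in begin
      ∏ (λ i → u i ^ℤ m i)
        ≈⟨ ∏.sum-cong-≋ split ⟩
      ∏ (λ i → u i ^ a i * v ^ℤ (+ C i ℤ.* t i))
        ≈⟨ ∏.∑-distrib-+ (λ i → u i ^ a i) (λ i → v ^ℤ (+ C i ℤ.* t i)) ⟩
      ∏ (λ i → u i ^ a i) * ∏ (λ i → v ^ℤ (+ C i ℤ.* t i))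
        ≈⟨ *-cong (admissible a ℤ.∣ e ℤ.- T ∣ adm a-off) (∏-^ℤ v≉0 (λ i → + C i ℤ.* t i)) ⟩
      v ^ ℤ.∣ e ℤ.- T ∣ * v ^ℤ T
        ≈⟨ *-congʳ (^ℤ-congʳ v +∣e-T∣≡e-T) ⟩
      v ^ℤ (e ℤ.- T) * v ^ℤ T
        ≈⟨ ^ℤ-homo-* v≉0 (e ℤ.- T) T ⟨
      v ^ℤ (e ℤ.- T ℤ.+ T)
        ≈⟨ ^ℤ-congʳ v (ring₁ e T) ⟩
      v ^ℤ e ∎
      where
      t : Fin n → ℤ
      t i = m i ℤ./ℕ M i
      a : Fin n → ℕ
      a i = m i ℤ.%ℕ M i
      m≡ : ∀ i → m i ≡ + a i ℤ.+ t i ℤ.* + M i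
      m≡ i = ℤ.a≡a%ℕn+[a/ℕn]*n (m i) (M i)
      T : ℤ
      T = ∑ℤ (λ i → + C i ℤ.* t i)

      a-off : ∀ i → Off i → a i ≡ 0
      a-off i o = ≡.trans (≡.cong (ℤ._%ℕ M i) (off i o)) (ℕ.m<n⇒m%n≡m (ℕ.>-nonZero⁻¹ (M i)))

      ring₁ : ∀ x y → x ℤ.- y ℤ.+ y ≡ x
      ring₁ = ℤ-Solver.solve-∀
      ring₂ : ∀ x t M w → (x ℤ.+ t ℤ.* M) ℤ.* w ≡ x ℤ.* w ℤ.+ M ℤ.* w ℤ.* t
      ring₂ = ℤ-Solver.solve-∀
      ring₃ : ∀ x y z → x ℤ.* y ℤ.* z ≡ x ℤ.* z ℤ.* y
      ring₃ = ℤ-Solver.solve-∀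
      ring₄ : ∀ x y z → x ≡ x ℤ.+ y ℤ.* z ℤ.- y ℤ.* z
      ring₄ = ℤ-Solver.solve-∀
      ring₅ : ∀ x y z → x ℤ.* z ℤ.- y ℤ.* z ≡ (x ℤ.- y) ℤ.* z
      ring₅ = ℤ-Solver.solve-∀
      ring₆ : ∀ M t → t ℤ.* M ≡ M ℤ.* t
      ring₆ = ℤ-Solver.solve-∀

      S : ℤ
      S = ∑ℤ (λ i → + a i ℤ.* + w i)

      S+T*N≡e*N : S ℤ.+ T ℤ.* + N ≡ e ℤ.* + N
      S+T*N≡e*N = let open ≡-Reasoning in begin
        S ℤ.+ T ℤ.* + N
          ≡⟨ ≡.cong (λ z → S ℤ.+ z) (*-distribʳ-∑ℤ (+ N) (λ i → + C i ℤ.* t i)) ⟩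
        S ℤ.+ ∑ℤ (λ i → + C i ℤ.* t i ℤ.* + N)
          ≡⟨ ∑ℤ-distrib-+ (λ i → + a i ℤ.* + w i) (λ i → + C i ℤ.* t i ℤ.* + N) ⟨
        ∑ℤ (λ i → + a i ℤ.* + w i ℤ.+ + C i ℤ.* t i ℤ.* + N)
          ≡⟨ ∑ℤ-cong (λ i → ≡.sym (≡.trans (≡.cong (ℤ._* + w i) (m≡ i))
               (≡.trans (ring₂ (+ a i) (t i) (+ M i) (+ w i))
                 (≡.cong (λ z → + a i ℤ.* + w i ℤ.+ z)
                   (≡.trans (≡.cong (ℤ._* t i) (M*w≡C*N i)) (ring₃ (+ C i) (+ N) (t i))))))) ⟩
        ∑ℤ (λ i → m i ℤ.* + w i)
          ≡⟨ weight ⟩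
        e ℤ.* + N ∎

      S≡[e-T]*N : S ≡ (e ℤ.- T) ℤ.* + N
      S≡[e-T]*N = ≡.trans (ring₄ S T (+ N))
        (≡.trans (≡.cong (ℤ._- T ℤ.* + N) S+T*N≡e*N) (ring₅ e T (+ N)))

      0≤S : 0ℤ ℤ.≤ S
      0≤S = ∑ℤ-nonneg (λ i → + a i ℤ.* + w i)
        (λ i → ≡.subst (0ℤ ℤ.≤_) (ℤ.pos-* (a i) (w i)) (ℤ.+≤+ ℕ.z≤n))

      -- The remainders are nonnegative and N is positive, so e - T is nonnegative and can serve as
      -- the natural exponent in `admissible`.
      +∣e-T∣≡e-T : + ℤ.∣ e ℤ.- T ∣ ≡ e ℤ.- T
      +∣e-T∣≡e-T = ℤ.0≤i⇒+∣i∣≡i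
        (ℤ.*-cancelʳ-≤-pos 0ℤ (e ℤ.- T) (+ N) {{ℤ.positive (ℤ.+<+ (ℕ.>-nonZero⁻¹ N))}}
          (≡.subst (0ℤ ℤ.≤_) S≡[e-T]*N 0≤S))

      adm : Admissible w D N a ℤ.∣ e ℤ.- T ∣
      adm = record
        { weight = ≡.trans S≡[e-T]*N (≡.cong (ℤ._* + N) (≡.sym +∣e-T∣≡e-T))
        ; upper  = λ i → ≡.subst (a i ℕ.* D i ℕ.≤_) (≡.sym (N≡M*D i))
            (ℕ.*-monoˡ-≤ (D i) (ℕ.<⇒≤ (ℤ.n%ℕd<d (m i) (M i))))
        }

      split : ∀ i → u i ^ℤ m i ≈ u i ^ a i * v ^ℤ (+ C i ℤ.* t i)
      split i with off? i
      ... | yes o = let open SetoidReasoning ≈-setoid in begin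
        u i ^ℤ m i                          ≈⟨ ^ℤ-congʳ (u i) (off i o) ⟩
        1#                                  ≈⟨ *-identityˡ 1# ⟨
        1# * 1#
          ≈⟨ *-cong (^ℤ-congʳ (u i) (≡.cong +_ (≡.sym (a-off i o)))) (^ℤ-congʳ v C*t≡0) ⟩
        u i ^ a i * v ^ℤ (+ C i ℤ.* t i)    ∎
        where
        t≡0 : t i ≡ 0ℤ
        t≡0 = ≡.trans (≡.cong (ℤ._/ℕ M i) (off i o)) (≡.cong +_ (ℕ.0/n≡0 (M i)))
        C*t≡0 : 0ℤ ≡ + C i ℤ.* t i
        C*t≡0 = ≡.sym (≡.trans (≡.cong (λ z → + C i ℤ.* z) t≡0) (ℤ.*-zeroʳ (+ C i)))
      ... | no on = let open SetoidReasoning ≈-setoid in begin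
        u i ^ℤ m i
          ≈⟨ ^ℤ-congʳ (u i) (≡.trans (m≡ i) (≡.cong (λ z → + a i ℤ.+ z) (ring₆ (+ M i) (t i)))) ⟩
        u i ^ℤ (+ a i ℤ.+ + M i ℤ.* t i)    ≈⟨ ^ℤ-homo-* (u≉0 i) (+ a i) (+ M i ℤ.* t i) ⟩
        u i ^ a i * u i ^ℤ (+ M i ℤ.* t i)  ≈⟨ *-congˡ (^ℤ-assoc (u≉0 i) (+ M i) (t i)) ⟨
        u i ^ a i * (u i ^ M i) ^ℤ t i      ≈⟨ *-congˡ (^ℤ-congˡ (t i) (u^M≈v^C i on)) ⟩
        u i ^ a i * (v ^ C i) ^ℤ t i        ≈⟨ *-congˡ (^ℤ-assoc v≉0 (+ C i) (t i)) ⟩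
        u i ^ a i * v ^ℤ (+ C i ℤ.* t i)    ∎

-- Field size, scaled monomials and ratios.

≢⇒1<n : ∀ {n} {i j : Fin n} → i ≢ j → 1 ℕ.< n
≢⇒1<n {suc zero}    {zero} {zero} i≢j = contradiction ≡.refl i≢j
≢⇒1<n {suc (suc n)} i≢j = s≤s (s≤s z≤n)

-- The enumeration separates 0 and 1. For the base field this makes q^r - 1 nonzero when r is
-- positive.
1<size : ∀ {c ℓ} (K : FiniteField c ℓ) → 1 ℕ.< FiniteField.size K
1<size K = ≢⇒1<n (1≉0 ∘ Injection.injective (Inverse⇒Injection enumeration))
  where open FiniteField K

module _ {c ℓ} (K : FiniteField c ℓ) where
  open FiniteField K hiding (zero; ring)
  open FieldProperties K
  open SetoidReasoning ≈-setoid

  -- A monomial of weight W is scaled by x^W. J-invariants are quotients of monomials of equal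
  -- weight, so they are fixed; the fine invariants have weight d, so they change by a d-th power.
  ∏-twist : ∀ {n x} → ¬ x ≈ 0# → (w : Fin n → ℕ) (a : Fin n → Carrier) (m : Fin n → ℤ) →
            ∏ (λ i → (x ^ w i * a i) ^ℤ m i) ≈ x ^ℤ ∑ℤ (λ i → m i ℤ.* + w i) * ∏ (λ i → a i ^ℤ m i)
  ∏-twist {x = x} x≉0 w a m = begin
    ∏ (λ i → (x ^ w i * a i) ^ℤ m i)
      ≈⟨ ∏.sum-cong-≋ (λ i → ^ℤ-distrib-* (x ^ w i) (a i) (m i)) ⟩
    ∏ (λ i → (x ^ w i) ^ℤ m i * a i ^ℤ m i)
      ≈⟨ ∏.∑-distrib-+ (λ i → (x ^ w i) ^ℤ m i) (λ i → a i ^ℤ m i) ⟩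
    ∏ (λ i → (x ^ w i) ^ℤ m i) * ∏ (λ i → a i ^ℤ m i)
      ≈⟨ *-congʳ (∏.sum-cong-≋ (λ i → trans (^ℤ-assoc x≉0 (+ w i) (m i)) (^ℤ-congʳ x (ℤ.*-comm (+ w i) (m i))))) ⟩
    ∏ (λ i → x ^ℤ (m i ℤ.* + w i)) * ∏ (λ i → a i ^ℤ m i)
      ≈⟨ *-congʳ (∏-^ℤ x≉0 (λ i → m i ℤ.* + w i)) ⟩
    x ^ℤ ∑ℤ (λ i → m i ℤ.* + w i) * ∏ (λ i → a i ^ℤ m i) ∎

  /-cancel-common : ∀ {x} a b → ¬ x ≈ 0# → (x * a) / (x * b) ≈ a / b
  /-cancel-common {x} a b x≉0 = begin
    x * a * (x * b) ⁻¹      ≈⟨ *-congˡ (⁻¹-distrib-* x b) ⟩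
    x * a * (x ⁻¹ * b ⁻¹)   ≈⟨ *-interchange _ _ _ _ ⟩
    x * x ⁻¹ * (a * b ⁻¹)   ≈⟨ *-congʳ (⁻¹-inverseʳ x≉0) ⟩
    1# * (a * b ⁻¹)         ≈⟨ *-identityˡ _ ⟩
    a / b                   ∎

  -- When a and b vanish, the value 1 keeps the ratio invertible, so that the laws of integer powers
  -- apply at every index.
  ratio : ∀ {a b} → a ≈ 0# ⇔ b ≈ 0# → ∃ λ x → ¬ x ≈ 0# × x * a ≈ b
  ratio {a} {b} a⇔b = case a ≟ 0# of λ where
      (yes a≈0) → 1# , 1≉0 , trans (*-identityˡ a) (trans a≈0 (sym (to a≈0)))
      (no  a≉0) → b / a , *-≉0 (a≉0 ∘ from) (⁻¹-≉0 a≉0) , /-cancelʳ a≉0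
    where open Equivalence a⇔b

-- Conjugation by a constant in L{τ}.

module _ {c ℓ c′ ℓ′} {𝔽 : FiniteField c ℓ} (L : FiniteAField 𝔽 c′ ℓ′) where
  open FiniteAField L hiding (zero; ring)
  open FieldProperties finiteField
  open L⟨τ⟩
  open SetoidReasoning ≈-setoid

  instance
    q-nonZero : NonZero q
    q-nonZero = ℕ.>-nonZero (ℕ.<-trans (s≤s z≤n) (1<size 𝔽))

  q^n≡1+[q^n∸1] : ∀ n → q ℕ.^ n ≡ suc (q ℕ.^ n ∸ 1)
  q^n≡1+[q^n∸1] n = ≡.sym (ℕ.m+[n∸m]≡n (ℕ.m^n>0 q n))

  q^[1+n]∸1-nonZero : ∀ n → NonZero (q ℕ.^ suc n ∸ 1)
  q^[1+n]∸1-nonZero n = ℕ.>-nonZero (ℕ.m<n⇒0<n∸m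
    (ℕ.<-≤-trans (1<size 𝔽) (ℕ.m≤m*n q (q ℕ.^ n) {{ℕ.m^n≢0 q n}})))

  coeff-+ₚ : ∀ f g n → coeff (f +ₚ g) n ≈ coeff f n + coeff g n
  coeff-+ₚ []      g       n       = sym (+-identityˡ _)
  coeff-+ₚ (a ∷ f) []      n       = sym (+-identityʳ _)
  coeff-+ₚ (a ∷ f) (b ∷ g) zero    = refl
  coeff-+ₚ (a ∷ f) (b ∷ g) (suc n) = coeff-+ₚ f g n

  coeff-map-* : ∀ a f n → coeff (List.map (a *_) f) n ≈ a * coeff f n
  coeff-map-* a []      n       = sym (zeroʳ a)
  coeff-map-* a (b ∷ f) zero    = refl
  coeff-map-* a (b ∷ f) (suc n) = coeff-map-* a f n

  coeff-const0 : ∀ n → coeff (const 0#) n ≈ 0#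
  coeff-const0 zero    = refl
  coeff-const0 (suc n) = refl

  coeff-const* : ∀ a f n → coeff (const a *ₚ f) n ≈ a * coeff f n
  coeff-const* a f n = begin
    coeff (List.map (a *_) f +ₚ const 0#) n           ≈⟨ coeff-+ₚ (List.map (a *_) f) (const 0#) n ⟩
    coeff (List.map (a *_) f) n + coeff (const 0#) n  ≈⟨ +-cong (coeff-map-* a f n) (coeff-const0 n) ⟩
    a * coeff f n + 0#                                ≈⟨ +-identityʳ _ ⟩
    a * coeff f n                                     ∎

  -- Each τ that a constant passes raises it to the q-th power, one step per recursive call of `*ₚ`;
  -- hence the induction goes from a to `a ^ q`.
  coeff-*const : ∀ f a n → coeff (f *ₚ const a) n ≈ coeff f n * a ^ (q ℕ.^ n)
  coeff-*const []      a n       = sym (zeroˡ _)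
  coeff-*const (b ∷ f) a zero    = trans (+-identityʳ _) (*-congˡ (sym (*-identityʳ a)))
  coeff-*const (b ∷ f) a (suc n) =
    trans (coeff-*const f (a ^ q) n) (*-congˡ (^-assocʳ a q (q ℕ.^ n)))

  -- The factor x ⁻¹ from the left meets x^(q^n) from the right.
  coeff-conjugate : ∀ {x} → ¬ x ≈ 0# → ∀ f n →
                    coeff (const (x ⁻¹) *ₚ f *ₚ const x) n ≈ x ^ (q ℕ.^ n ∸ 1) * coeff f n
  coeff-conjugate {x} x≉0 f n = begin
    coeff (const (x ⁻¹) *ₚ f *ₚ const x) n
      ≈⟨ coeff-*const (const (x ⁻¹) *ₚ f) x n ⟩
    coeff (const (x ⁻¹) *ₚ f) n * x ^ (q ℕ.^ n)
      ≈⟨ *-cong (coeff-const* (x ⁻¹) f n) (^ℤ-congʳ x (≡.cong +_ (q^n≡1+[q^n∸1] n))) ⟩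
    x ⁻¹ * coeff f n * (x * x ^ (q ℕ.^ n ∸ 1))
      ≈⟨ *-interchange _ _ _ _ ⟩
    x ⁻¹ * x * (coeff f n * x ^ (q ℕ.^ n ∸ 1))
      ≈⟨ *-congʳ (⁻¹-inverseˡ x≉0) ⟩
    1# * (coeff f n * x ^ (q ℕ.^ n ∸ 1))
      ≈⟨ *-identityˡ _ ⟩
    coeff f n * x ^ (q ℕ.^ n ∸ 1)
      ≈⟨ *-comm _ _ ⟩
    x ^ (q ℕ.^ n ∸ 1) * coeff f n ∎

-- Indices of coefficients and existence of Bézout vectors.

index-elim : ∀ {p} r (P : ℕ → Set p) → P 0 → (∀ (i : Fin r) → P (index i)) →
             (∀ k → r ℕ.< k → P k) → ∀ k → P k
index-elim r P P0 Pi P> zero = P0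
index-elim r P P0 Pi P> (suc k) with k ℕ.<? r
... | yes k<r = ≡.subst (P ∘ suc) (Fin.toℕ-fromℕ< k<r) (Pi (fromℕ< k<r))
... | no  k≮r = P> (suc k) (s≤s (ℕ.≮⇒≥ k≮r))

lookup≡false : ∀ {n} {S : Subset n} {i} → i ∉ S → Vec.lookup S i ≡ false
lookup≡false {S = S} {i} i∉S with Vec.lookup S i in eq
... | false = ≡.refl
... | true  = contradiction (Vec.lookup⇒[]= i S eq) i∉S

-- In `gcdOver` the weights outside S are replaced by 0, so the Bézout coefficients there contribute
-- nothing and can be reset to 0.
isBézout : ∀ q {r} (S : Subset r) → ∃ (IsBézout q S)
isBézout q {r} S with x , gcd≡ ← gcdFold-bézout (λ (i : Fin r) → if Vec.lookup S i then q ℕ.^ index i ∸ 1 else 0) =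
  (λ i → if Vec.lookup S i then x i else 0ℤ) , record
  { supported = λ i i∉S → ≡.cong (if_then x i else 0ℤ) (lookup≡false i∉S)
  ; bézout    = ≡.trans gcd≡ (∑ℤ-cong (λ i → term (Vec.lookup S i) (x i) (q ℕ.^ index i ∸ 1)))
  }
  where
  term : ∀ b x n → x ℤ.* + (if b then n else 0) ≡ (if b then x else 0ℤ) ℤ.* + n
  term true  x n = ≡.refl
  term false x n = ℤ.*-zeroʳ x

-- Isomorphic modules have equal invariants.

module _ {c ℓ c′ ℓ′} {𝔽 : FiniteField c ℓ} {L : FiniteAField 𝔽 c′ ℓ′} {r : ℕ} where
  open FiniteAField L hiding (zero; ring)
  open FieldProperties finiteField
  open DrinfeldModule using (g)
  open SetoidReasoning ≈-setoid

  private
    weight : Fin r → ℕ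
    weight i = q ℕ.^ index i ∸ 1

  Twist : Carrier → DrinfeldModule L r → DrinfeldModule L r → Set ℓ′
  Twist x Φ Ψ = ∀ k → g Ψ k ≈ x ^ (q ℕ.^ k ∸ 1) * g Φ k

  ≅⇔Twist : ∀ {Φ Ψ : DrinfeldModule L r} → (Φ ≅ Ψ) ⇔ (∃ λ x → ¬ x ≈ 0# × Twist x Φ Ψ)
  ≅⇔Twist {Φ} = mk⇔
    (λ (x , x≉0 , Ψ≈) → x , x≉0 , λ k → trans (Ψ≈ k) (coeff-conjugate L x≉0 (DrinfeldModule.φ Φ (𝔽[T].T 𝔽)) k))
    (λ (x , x≉0 , tw) → x , x≉0 , λ k → trans (tw k) (sym (coeff-conjugate L x≉0 (DrinfeldModule.φ Φ (𝔽[T].T 𝔽)) k)))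

  lookup-I : ∀ (Φ : DrinfeldModule L r) i → Vec.lookup (I Φ) i ≡ not (does (g Φ (index i) ≟ 0#))
  lookup-I Φ i = Vec.lookup∘tabulate _ i

  ≉0⇒lookup-I≡true : ∀ (Φ : DrinfeldModule L r) i → ¬ g Φ (index i) ≈ 0# → Vec.lookup (I Φ) i ≡ true
  ≉0⇒lookup-I≡true Φ i g≉0 = ≡.trans (lookup-I Φ i) (≡.cong not (dec-false (g Φ (index i) ≟ 0#) g≉0))

  ≈0⇒∉I : ∀ (Φ : DrinfeldModule L r) i → g Φ (index i) ≈ 0# → i ∉ I Φ
  ≈0⇒∉I Φ i g≈0 i∈I = case ≡.trans (≡.sym (Vec.[]=⇒lookup i∈I))
    (≡.trans (lookup-I Φ i) (≡.cong not (dec-true (g Φ (index i) ≟ 0#) g≈0))) of λ ()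

  I-cong : ∀ {Φ Ψ : DrinfeldModule L r} → (∀ i → g Φ (index i) ≈ 0# ⇔ g Ψ (index i) ≈ 0#) → I Φ ≡ I Ψ
  I-cong {Φ} {Ψ} Φ⇔Ψ = Vec.tabulate-cong (λ i → ≡.cong not (does-⇔ (Φ⇔Ψ i) (g Φ (index i) ≟ 0#) (g Ψ (index i) ≟ 0#)))

  ≈0-resp-I : ∀ {Φ Ψ : DrinfeldModule L r} → I Φ ≡ I Ψ → ∀ i → g Φ (index i) ≈ 0# → g Ψ (index i) ≈ 0#
  ≈0-resp-I {Φ} {Ψ} I≡ i gΦ≈0 with g Ψ (index i) ≟ 0#
  ... | yes gΨ≈0 = gΨ≈0
  ... | no  gΨ≉0 = contradiction
    (≡.subst (i ∈_) (≡.sym I≡) (Vec.lookup⇒[]= i (I Ψ) (≉0⇒lookup-I≡true Ψ i gΨ≉0)))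
    (≈0⇒∉I Φ i gΦ≈0)

  -- Vanishing coefficients enter with exponent 0, and 0⁰ = 1.
  ∏g≉0 : ∀ {n} (Φ : DrinfeldModule L r) (k : Fin n → ℕ) (m : Fin n → ℤ) → (∀ i → g Φ (k i) ≈ 0# → m i ≡ 0ℤ) →
         ¬ ∏ (λ i → g Φ (k i) ^ℤ m i) ≈ 0#
  ∏g≉0 Φ k m off = ∏-≉0 (λ i → g Φ (k i) ^ℤ m i) λ i → case g Φ (k i) ≟ 0# of λ where
    (yes g≈0) → ≡.subst (λ z → ¬ g Φ (k i) ^ℤ z ≈ 0#) (≡.sym (off i g≈0)) 1≉0
    (no  g≉0) → ^ℤ-≉0 g≉0 (m i)

  module _ {Φ Ψ : DrinfeldModule L r} {x} (x≉0 : ¬ x ≈ 0#) (tw : Twist x Φ Ψ) where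

    -- By condition (a) numerator and denominator are scaled by the same power of x.
    Twist⇒J : ∀ β → J β Φ ≈ J β Ψ
    Twist⇒J β = sym (begin
      ∏ (λ i → g Ψ (k i) ^ℤ δ i) / g Ψ r ^ℤ δᵣ
        ≈⟨ *-cong (∏.sum-cong-≋ (λ i → ^ℤ-congˡ (δ i) (tw (k i)))) (⁻¹-cong (^ℤ-congˡ δᵣ (tw r))) ⟩
      ∏ (λ i → (x ^ (q ℕ.^ k i ∸ 1) * g Φ (k i)) ^ℤ δ i) / (x ^ (q ℕ.^ r ∸ 1) * g Φ r) ^ℤ δᵣ
        ≈⟨ *-cong (∏-twist finiteField x≉0 (λ i → q ℕ.^ k i ∸ 1) (λ i → g Φ (k i)) δ)
                  (⁻¹-cong (trans (^ℤ-distrib-* _ _ δᵣ) (*-congʳ (^ℤ-assoc x≉0 (+ (q ℕ.^ r ∸ 1)) δᵣ)))) ⟩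
      (x ^ℤ ∑ℤ (λ i → δ i ℤ.* + (q ℕ.^ k i ∸ 1)) * ∏ (λ i → g Φ (k i) ^ℤ δ i))
        / (x ^ℤ (+ (q ℕ.^ r ∸ 1) ℤ.* δᵣ) * g Φ r ^ℤ δᵣ)
        ≈⟨ *-congʳ (*-congʳ (^ℤ-congʳ x (≡.trans weight-eq (ℤ.*-comm δᵣ (+ (q ℕ.^ r ∸ 1)))))) ⟩
      (x ^ℤ (+ (q ℕ.^ r ∸ 1) ℤ.* δᵣ) * ∏ (λ i → g Φ (k i) ^ℤ δ i))
        / (x ^ℤ (+ (q ℕ.^ r ∸ 1) ℤ.* δᵣ) * g Φ r ^ℤ δᵣ)
        ≈⟨ /-cancel-common finiteField _ _ (^ℤ-≉0 x≉0 (+ (q ℕ.^ r ∸ 1) ℤ.* δᵣ)) ⟩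
      ∏ (λ i → g Φ (k i) ^ℤ δ i) / g Φ r ^ℤ δᵣ ∎)
      where open BasicIndex β renaming (weight to weight-eq)

    Twist⇒SameFI : SameFI Φ Ψ
    -- `SameClassModPowers` puts the d-th power on the side of Ψ, whereas the twist scales Φ; hence
    -- the witness x ⁻¹.
    Twist⇒SameFI = I-cong {Φ} {Ψ} (λ i → mk⇔ (to i) (from i)) , λ λs isB → x ⁻¹ , ⁻¹-≉0 x≉0 , same λs isB
      where
      to : ∀ i → g Φ (index i) ≈ 0# → g Ψ (index i) ≈ 0#
      to i gΦ≈0 = trans (tw (index i)) (trans (*-congˡ gΦ≈0) (zeroʳ _))
      from : ∀ i → g Ψ (index i) ≈ 0# → g Φ (index i) ≈ 0#
      from i gΨ≈0 = *-cancelˡ (^-≉0 x≉0 (weight i))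
        (trans (trans (sym (tw (index i))) gΨ≈0) (sym (zeroʳ _)))
      d : ℕ
      d = gcdOver q (I Φ)
      same : ∀ λs → IsBézout q (I Φ) λs →
             FI-representative λs Φ ≈ (x ⁻¹) ^ d * FI-representative λs Ψ
      same λs isB = sym (begin
        (x ⁻¹) ^ d * FI-representative λs Ψ
          ≈⟨ *-congˡ (∏.sum-cong-≋ (λ i → ^ℤ-congˡ (λs i) (tw (index i)))) ⟩
        (x ⁻¹) ^ d * ∏ (λ i → (x ^ weight i * g Φ (index i)) ^ℤ λs i)
          ≈⟨ *-congˡ (∏-twist finiteField x≉0 weight (λ i → g Φ (index i)) λs) ⟩
        (x ⁻¹) ^ d * (x ^ℤ ∑ℤ (λ i → λs i ℤ.* + weight i) * FI-representative λs Φ)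
          ≈⟨ *-congˡ (*-congʳ (^ℤ-congʳ x (IsBézout.bézout isB))) ⟨
        (x ⁻¹) ^ d * (x ^ d * FI-representative λs Φ)
          ≈⟨ *-assoc _ _ _ ⟨
        (x ⁻¹) ^ d * x ^ d * FI-representative λs Φ
          ≈⟨ *-congʳ (^-distrib-* (x ⁻¹) x d) ⟨
        (x ⁻¹ * x) ^ d * FI-representative λs Φ
          ≈⟨ *-congʳ (trans (^-congˡ d (⁻¹-inverseˡ x≉0)) (1^n≈1 d)) ⟩
        1# * FI-representative λs Φ
          ≈⟨ *-identityˡ _ ⟩
        FI-representative λs Φ ∎)

-- Equal invariants give an isomorphism.

module _ {c ℓ c′ ℓ′} {𝔽 : FiniteField c ℓ} {L : FiniteAField 𝔽 c′ ℓ′} where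
  open FiniteAField L hiding (zero; ring)
  open FieldProperties finiteField
  open DrinfeldModule using (g; constant-term; leading-term; no-higher-terms)

  module Converse {s} (Φ Ψ : DrinfeldModule L (suc s)) (J≈ : ∀ β → J β Φ ≈ J β Ψ) (sameFI : SameFI Φ Ψ)
    where

    -- Degree 0 is the value of γ at T for both modules, degrees 1 to r are governed by the common
    -- index set, and above r both coefficients vanish.
    g≈0⇔ : ∀ k → g Φ k ≈ 0# ⇔ g Ψ k ≈ 0#
    g≈0⇔ = index-elim (suc s) (λ k → g Φ k ≈ 0# ⇔ g Ψ k ≈ 0#)
      (mk⇔ (trans (trans (constant-term Ψ) (sym (constant-term Φ))))
           (trans (trans (constant-term Φ) (sym (constant-term Ψ)))))
      (λ i → mk⇔ (≈0-resp-I {Φ = Φ} {Ψ} (proj₁ sameFI) i) (≈0-resp-I {Φ = Ψ} {Φ} (≡.sym (proj₁ sameFI)) i))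
      (λ k r<k → mk⇔ (λ _ → no-higher-terms Ψ k r<k) (λ _ → no-higher-terms Φ k r<k))

    ρ : ℕ → Carrier
    ρ k = proj₁ (ratio finiteField (g≈0⇔ k))

    ρ≉0 : ∀ k → ¬ ρ k ≈ 0#
    ρ≉0 k = proj₁ (proj₂ (ratio finiteField (g≈0⇔ k)))

    ρ*g : ∀ k → ρ k * g Φ k ≈ g Ψ k
    ρ*g k = proj₂ (proj₂ (ratio finiteField (g≈0⇔ k)))

    ρ^*g^ : ∀ k m → g Ψ k ^ℤ m ≈ ρ k ^ℤ m * g Φ k ^ℤ m
    ρ^*g^ k m = trans (^ℤ-congˡ m (sym (ρ*g k))) (^ℤ-distrib-* (ρ k) (g Φ k) m)

    ∏ρ^*∏g^ : ∀ {n} (k : Fin n → ℕ) (m : Fin n → ℤ) →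
              ∏ (λ i → g Ψ (k i) ^ℤ m i) ≈ ∏ (λ i → ρ (k i) ^ℤ m i) * ∏ (λ i → g Φ (k i) ^ℤ m i)
    ∏ρ^*∏g^ k m = trans (∏.sum-cong-≋ (λ i → ρ^*g^ (k i) (m i)))
      (∏.∑-distrib-+ (λ i → ρ (k i) ^ℤ m i) (λ i → g Φ (k i) ^ℤ m i))

    w D : ∀ {n} → Fin n → ℕ
    w i = q ℕ.^ index i ∸ 1
    D i = q ℕ.^ ℕ.gcd (index i) (suc s) ∸ 1

    N : ℕ
    N = q ℕ.^ suc s ∸ 1

    -- All of 1, ..., r - 1 are taken as the kᵢ; those that should not occur get exponent 0, which
    -- (b) permits.
    basicIndex : ∀ (a : Fin s → ℕ) e → Admissible w D N a e → gcdFold e a ≡ 1 → BasicIndex q (suc s)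
    basicIndex a e adm gcd≡1 = record
      { l            = s
      ; k            = index
      ; k-lower      = λ i → s≤s z≤n
      ; k-increasing = s≤s
      ; k-upper      = Fin.toℕ<n
      ; δ            = λ i → + a i
      ; δᵣ           = + e
      ; weight       = weight
      ; δ-lower      = λ i → ℤ.+≤+ z≤n
      ; δ-upper      = λ i → ≡.subst (ℤ._≤ + N) (ℤ.pos-* (a i) (D i)) (ℤ.+≤+ (upper i))
      ; δ-coprime    = ≡.trans (foldr-gcd-+ e a) (≡.cong +_ gcd≡1)
      }
      where open Admissible adm

    -- The ratio of J(Ψ) to J(Φ) is the left side divided by the right. The condition on vanishing
    -- coefficients makes J(Φ) = A / B nonzero, so it can be cancelled.
    primitive-relation : ∀ (a : Fin s → ℕ) e → Admissible w D N a e → gcdFold e a ≡ 1 →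
      (∀ i → g Φ (index i) ≈ 0# → a i ≡ 0) → ∏ (λ i → ρ (index i) ^ a i) ≈ ρ (suc s) ^ e
    primitive-relation a e adm gcd≡1 off = *-cancelʳ A/B≉0 (begin
      ∏ (λ i → ρ (index i) ^ a i) * (A / B)            ≈⟨ *-assoc _ _ _ ⟨
      ∏ (λ i → ρ (index i) ^ a i) * A / B              ≈⟨ *-congʳ (∏ρ^*∏g^ index (λ i → + a i)) ⟨
      A′ / B                                           ≈⟨ /-cancel-common finiteField A′ B R≉0 ⟨
      (R * A′) / (R * B)                               ≈⟨ *-congˡ (⁻¹-cong (ρ^*g^ (suc s) (+ e))) ⟨
      R * A′ / B′                                      ≈⟨ *-assoc _ _ _ ⟩
      R * (A′ / B′)                                    ≈⟨ *-congˡ (J≈ (basicIndex a e adm gcd≡1)) ⟨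
      R * (A / B)                                      ∎)
      where
      open SetoidReasoning ≈-setoid
      A A′ B B′ R : Carrier
      A  = ∏ (λ (i : Fin s) → g Φ (index i) ^ a i)
      A′ = ∏ (λ (i : Fin s) → g Ψ (index i) ^ a i)
      B  = g Φ (suc s) ^ e
      B′ = g Ψ (suc s) ^ e
      R  = ρ (suc s) ^ e
      R≉0 : ¬ R ≈ 0#
      R≉0 = ^-≉0 (ρ≉0 (suc s)) e
      A/B≉0 : ¬ A / B ≈ 0#
      A/B≉0 = *-≉0 (∏g≉0 {n = s} Φ index (λ i → + a i) (λ i g≈0 → ≡.cong +_ (off i g≈0)))
                   (⁻¹-≉0 (^-≉0 (leading-term Φ) e))

    open Generation finiteField {s} w D N {{q^[1+n]∸1-nonZero L s}}
      (λ i → q^d∸1∣q^n∸1 q {{q-nonZero L}} (ℕ.gcd[m,n]∣m (index i) (suc s)))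
      (λ i → q^d∸1∣q^n∸1 q {{q-nonZero L}} (ℕ.gcd[m,n]∣n (index i) (suc s)))
      (ρ ∘ index) (ρ≉0 ∘ index) (ρ (suc s)) (ρ≉0 (suc s))
      (λ i → g Φ (index i) ≟ 0#) primitive-relation
      using (generation)

    Supported : (Fin (suc s) → ℤ) → Set ℓ′
    Supported m = ∀ i → g Φ (index i) ≈ 0# → m i ≡ 0ℤ

    ρ^ : (Fin (suc s) → ℤ) → Carrier
    ρ^ m = ∏ (λ i → ρ (index i) ^ℤ m i)

    index-inject₁ : ∀ (i : Fin s) → index (inject₁ i) ≡ index i
    index-inject₁ i = ≡.cong suc (Fin.toℕ-inject₁ i)

    index-fromℕ : index (fromℕ s) ≡ suc s
    index-fromℕ = ≡.cong suc (Fin.toℕ-fromℕ s)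

    -- Splitting off the last index, which is r, leaves a vector of weight - e N on the indices
    -- below r, the form required by `generation`.
    relation : ∀ m → Supported m → ∑ℤ (λ i → m i ℤ.* + w i) ≡ 0ℤ → ρ^ m ≈ 1#
    relation m supp weight≡0 = let open SetoidReasoning ≈-setoid in begin
      ρ^ m
        ≈⟨ ∏.sum-init-last (λ i → ρ (index i) ^ℤ m i) ⟩
      ∏ (λ i → ρ (index (inject₁ i)) ^ℤ m (inject₁ i)) * ρ (index (fromℕ s)) ^ℤ e
        ≈⟨ *-cong (∏.sum-cong-≋ (λ i → reflexive (≡.cong (λ k → ρ k ^ℤ m (inject₁ i)) (index-inject₁ i))))
                  (reflexive (≡.cong (λ k → ρ k ^ℤ e) index-fromℕ)) ⟩
      ∏ (λ i → ρ (index i) ^ℤ m (inject₁ i)) * ρ (suc s) ^ℤ e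
        ≈⟨ *-congʳ (generation (m ∘ inject₁) (ℤ.- e) weight supp′) ⟩
      ρ (suc s) ^ℤ (ℤ.- e) * ρ (suc s) ^ℤ e
        ≈⟨ ^ℤ-homo-* (ρ≉0 (suc s)) (ℤ.- e) e ⟨
      ρ (suc s) ^ℤ (ℤ.- e ℤ.+ e)
        ≈⟨ ^ℤ-congʳ (ρ (suc s)) (ℤ.+-inverseˡ e) ⟩
      1# ∎
      where
      e : ℤ
      e = m (fromℕ s)
      supp′ : ∀ i → g Φ (index i) ≈ 0# → m (inject₁ i) ≡ 0ℤ
      supp′ i g≈0 = supp (inject₁ i) (≡.subst (λ k → g Φ k ≈ 0#) (≡.sym (index-inject₁ i)) g≈0)
      S : ℤ
      S = ∑ℤ (λ i → m (inject₁ i) ℤ.* + w i)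
      ring₁ : ∀ x y z → x ≡ x ℤ.+ y ℤ.* z ℤ.+ ℤ.- y ℤ.* z
      ring₁ = ℤ-Solver.solve-∀
      weight : S ≡ ℤ.- e ℤ.* + N
      weight = let open ≡-Reasoning in begin
        S
          ≡⟨ ring₁ S e (+ N) ⟩
        S ℤ.+ e ℤ.* + N ℤ.+ ℤ.- e ℤ.* + N
          ≡⟨ ≡.cong (ℤ._+ ℤ.- e ℤ.* + N) (≡.cong₂ ℤ._+_
               (∑ℤ-cong (λ i → ≡.cong (λ k → m (inject₁ i) ℤ.* + (q ℕ.^ k ∸ 1)) (index-inject₁ i)))
               (≡.cong (λ k → e ℤ.* + (q ℕ.^ k ∸ 1)) index-fromℕ)) ⟨
        ∑ℤ (λ i → m (inject₁ i) ℤ.* + w (inject₁ i)) ℤ.+ e ℤ.* + w (fromℕ s) ℤ.+ ℤ.- e ℤ.* + N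
          ≡⟨ ≡.cong (ℤ._+ ℤ.- e ℤ.* + N) (∑ℤ-init-last (λ i → m i ℤ.* + w i)) ⟨
        ∑ℤ (λ i → m i ℤ.* + w i) ℤ.+ ℤ.- e ℤ.* + N
          ≡⟨ ≡.cong (ℤ._+ ℤ.- e ℤ.* + N) weight≡0 ⟩
        0ℤ ℤ.+ ℤ.- e ℤ.* + N
          ≡⟨ ℤ.+-identityˡ _ ⟩
        ℤ.- e ℤ.* + N ∎

    -- The difference of the two vectors is supported and has weight 0.
    ρ^-cong-weight : ∀ m m′ → Supported m → Supported m′ →
      ∑ℤ (λ i → m i ℤ.* + w i) ≡ ∑ℤ (λ i → m′ i ℤ.* + w i) → ρ^ m ≈ ρ^ m′
    ρ^-cong-weight m m′ supp supp′ weight≡ = let open SetoidReasoning ≈-setoid in begin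
      ρ^ m
        ≈⟨ ∏.sum-cong-≋ (λ i → trans (^ℤ-congʳ (ρ (index i)) (ring₁ (m i) (m′ i)))
                                     (^ℤ-homo-* (ρ≉0 (index i)) (m i ℤ.- m′ i) (m′ i))) ⟩
      ∏ (λ i → ρ (index i) ^ℤ (m i ℤ.- m′ i) * ρ (index i) ^ℤ m′ i)
        ≈⟨ ∏.∑-distrib-+ (λ i → ρ (index i) ^ℤ (m i ℤ.- m′ i)) (λ i → ρ (index i) ^ℤ m′ i) ⟩
      ρ^ (λ i → m i ℤ.- m′ i) * ρ^ m′
        ≈⟨ *-congʳ (relation (λ i → m i ℤ.- m′ i) (λ i g≈0 → ≡.cong₂ ℤ._-_ (supp i g≈0) (supp′ i g≈0)) weight) ⟩
      1# * ρ^ m′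
        ≈⟨ *-identityˡ _ ⟩
      ρ^ m′ ∎
      where
      ring₁ : ∀ x y → x ≡ x ℤ.- y ℤ.+ y
      ring₁ = ℤ-Solver.solve-∀
      ring₂ : ∀ x y z → (x ℤ.- y) ℤ.* z ℤ.+ y ℤ.* z ≡ x ℤ.* z
      ring₂ = ℤ-Solver.solve-∀
      weight : ∑ℤ (λ i → (m i ℤ.- m′ i) ℤ.* + w i) ≡ 0ℤ
      weight = +ℤ-cancelʳ _ _ _ (let open ≡-Reasoning in begin
        ∑ℤ (λ i → (m i ℤ.- m′ i) ℤ.* + w i) ℤ.+ ∑ℤ (λ i → m′ i ℤ.* + w i)
          ≡⟨ ∑ℤ-distrib-+ (λ i → (m i ℤ.- m′ i) ℤ.* + w i) (λ i → m′ i ℤ.* + w i) ⟨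
        ∑ℤ (λ i → (m i ℤ.- m′ i) ℤ.* + w i ℤ.+ m′ i ℤ.* + w i)
          ≡⟨ ∑ℤ-cong (λ i → ring₂ (m i) (m′ i) (+ w i)) ⟩
        ∑ℤ (λ i → m i ℤ.* + w i)
          ≡⟨ weight≡ ⟩
        ∑ℤ (λ i → m′ i ℤ.* + w i)
          ≡⟨ ℤ.+-identityˡ _ ⟨
        0ℤ ℤ.+ ∑ℤ (λ i → m′ i ℤ.* + w i) ∎)

    d : ℕ
    d = gcdOver q (I Φ)

    d∣w : ∀ (i : Fin (suc s)) → ¬ g Φ (index i) ≈ 0# → d ∣ w i
    d∣w i g≉0 = ≡.subst (λ b → d ∣ (if b then w i else 0)) (≉0⇒lookup-I≡true Φ i g≉0)
      (gcdFold∣ 0 (λ j → if Vec.lookup (I Φ) j then w j else 0) i)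

    module _ {λs} (isB : IsBézout q (I Φ) λs) {z} (z≉0 : ¬ z ≈ 0#)
      (FI≈ : FI-representative λs Φ ≈ z ^ d * FI-representative λs Ψ) where

      open IsBézout isB

      λs-supported : Supported λs
      λs-supported i g≈0 = supported i (≈0⇒∉I Φ i g≈0)

      -- The factor z ^ d stands on the side of Ψ, whereas a twist scales Φ; hence the inverse.
      x : Carrier
      x = z ⁻¹

      -- The representative for Ψ is `ρ^ λs` times the one for Φ. The latter is nonzero, and
      -- cancelling it leaves z^d times `ρ^ λs` equal to 1.
      ρ^λs≈x^d : ρ^ λs ≈ x ^ d
      ρ^λs≈x^d = *-cancelˡ (^-≉0 z≉0 d) (*-cancelʳ (∏g≉0 Φ index λs λs-supported) (begin
        z ^ d * ρ^ λs * FIΦ          ≈⟨ *-assoc _ _ _ ⟩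
        z ^ d * (ρ^ λs * FIΦ)        ≈⟨ *-congˡ (∏ρ^*∏g^ index λs) ⟨
        z ^ d * FIΨ                  ≈⟨ FI≈ ⟨
        FIΦ                          ≈⟨ *-identityˡ _ ⟨
        1# * FIΦ                     ≈⟨ *-congʳ (1^n≈1 d) ⟨
        1# ^ d * FIΦ                 ≈⟨ *-congʳ (^-congˡ d (⁻¹-inverseʳ z≉0)) ⟨
        (z * x) ^ d * FIΦ            ≈⟨ *-congʳ (^-distrib-* z x d) ⟩
        z ^ d * x ^ d * FIΦ          ∎))
        where
        open SetoidReasoning ≈-setoid
        FIΦ FIΨ : Carrier
        FIΦ = FI-representative λs Φ
        FIΨ = FI-representative λs Ψ

      ρ≈x^w : ∀ (k : Fin (suc s)) → ¬ g Φ (index k) ≈ 0# → ρ (index k) ≈ x ^ w k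
      ρ≈x^w k g≉0 = let open SetoidReasoning ≈-setoid in begin
        ρ (index k)
          ≈⟨ *-identityʳ _ ⟨
        ρ (index k) ^ 1
          ≈⟨ ^ℤ-congʳ (ρ (index k)) (≡.cong +_ (single-≡ k 1)) ⟨
        ρ (index k) ^ single k 1 k
          ≈⟨ ∏.sum-single _ k (λ i i≢k → ^ℤ-congʳ (ρ (index i)) (≡.cong +_ (single-≢ k 1 i i≢k))) ⟨
        ρ^ (λ i → + single k 1 i)
          -- Both vectors have weight w k: λ has weight d, and w k = t d.
          ≈⟨ ρ^-cong-weight _ _
               (λ i g≈0 → ≡.cong +_ (single-≢ k 1 i λ { ≡.refl → g≉0 g≈0 }))
               (λ i g≈0 → ≡.cong (ℤ._* + t) (λs-supported i g≈0))
               weight ⟩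
        ρ^ (λ i → λs i ℤ.* + t)
          ≈⟨ ∏.sum-cong-≋ (λ i → ^ℤ-assoc (ρ≉0 (index i)) (λs i) (+ t)) ⟨
        ∏ (λ i → (ρ (index i) ^ℤ λs i) ^ t)
          ≈⟨ ^ℤ-distrib-∏ (λ i → ρ (index i) ^ℤ λs i) (+ t) ⟨
        ρ^ λs ^ t
          ≈⟨ ^-congˡ t (ρ^λs≈x^d) ⟩
        (x ^ d) ^ t
          ≈⟨ ^-assocʳ x d t ⟩
        x ^ (d ℕ.* t)
          ≈⟨ ^ℤ-congʳ x (≡.cong +_ (≡.trans (ℕ.*-comm d t) (≡.sym w≡t*d))) ⟩
        x ^ w k ∎
        where
        t : ℕ
        t = _∣_.quotient (d∣w k g≉0)
        w≡t*d : w k ≡ t ℕ.* d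
        w≡t*d = _∣_.equality (d∣w k g≉0)
        ring₁ : ∀ x y z → x ℤ.* (y ℤ.* z) ≡ y ℤ.* x ℤ.* z
        ring₁ = ℤ-Solver.solve-∀
        weight : ∑ℤ (λ i → + single k 1 i ℤ.* + w i) ≡ ∑ℤ (λ i → λs i ℤ.* + t ℤ.* + w i)
        weight = let open ≡-Reasoning in begin
          ∑ℤ (λ i → + single k 1 i ℤ.* + w i)     ≡⟨ ∑ℤ-single-* k 1 w ⟩
          + 1 ℤ.* + w k                           ≡⟨ ℤ.*-identityˡ (+ w k) ⟩
          + w k                                   ≡⟨ ≡.cong +_ w≡t*d ⟩
          + (t ℕ.* d)                             ≡⟨ ℤ.pos-* t d ⟩
          + t ℤ.* + d                             ≡⟨ ≡.cong (λ z → + t ℤ.* z) bézout ⟩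
          + t ℤ.* ∑ℤ (λ i → λs i ℤ.* + w i)       ≡⟨ *-distribˡ-∑ℤ (+ t) (λ i → λs i ℤ.* + w i) ⟩
          ∑ℤ (λ i → + t ℤ.* (λs i ℤ.* + w i))     ≡⟨ ∑ℤ-cong (λ i → ring₁ (+ t) (λs i) (+ w i)) ⟩
          ∑ℤ (λ i → λs i ℤ.* + t ℤ.* + w i)       ∎

      twist : Twist x Φ Ψ
      twist = index-elim (suc s) (λ k → g Ψ k ≈ x ^ (q ℕ.^ k ∸ 1) * g Φ k)
        (trans (constant-term Ψ) (trans (sym (constant-term Φ)) (sym (*-identityˡ _))))
        (λ i → trans (sym (ρ*g (index i))) (twist-index i))
        (λ k r<k → trans (no-higher-terms Ψ k r<k)
          (sym (trans (*-congˡ (no-higher-terms Φ k r<k)) (zeroʳ _))))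
        where
        twist-index : ∀ (i : Fin (suc s)) → ρ (index i) * g Φ (index i) ≈ x ^ w i * g Φ (index i)
        twist-index i = case g Φ (index i) ≟ 0# of λ where
          -- Here ρ is only the placeholder 1 and need not be a power of x, but both sides are 0.
          (yes g≈0) → trans (trans (*-congˡ g≈0) (zeroʳ _)) (sym (trans (*-congˡ g≈0) (zeroʳ _)))
          (no  g≉0) → *-congʳ (ρ≈x^w i g≉0)

theorem2p2 : ∀ {c ℓ c′ ℓ′} (𝔽 : FiniteField c ℓ) (L : FiniteAField 𝔽 c′ ℓ′) (r : ℕ) (Φ Ψ : DrinfeldModule L r) →
    Φ ≅ Ψ ⇔ ((∀ (β : BasicIndex (FiniteAField.q L) r) → FiniteAField._≈_ L (J β Φ) (J β Ψ)) × SameFI Φ Ψ)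
theorem2p2 𝔽 L zero Φ Ψ = contradiction (DrinfeldModule.rank-positive Φ) λ ()
theorem2p2 𝔽 L (suc s) Φ Ψ = mk⇔ invariant determined
  where
  open FiniteAField L using (q; finiteField; _≈_; 0#)

  invariant : Φ ≅ Ψ → (∀ β → J β Φ ≈ J β Ψ) × SameFI Φ Ψ
  invariant Φ≅Ψ =
    let x , x≉0 , tw = Equivalence.to (≅⇔Twist {Φ = Φ} {Ψ}) Φ≅Ψ
    in Twist⇒J {Φ = Φ} {Ψ} x≉0 tw , Twist⇒SameFI {Φ = Φ} {Ψ} x≉0 tw

  determined : (∀ β → J β Φ ≈ J β Ψ) × SameFI Φ Ψ → Φ ≅ Ψ
  determined (J≈ , sameFI) =
    let λs , isB = isBézout q (I Φ)
        z , z≉0 , FI≈ = proj₂ sameFI λs isB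
    in Equivalence.from (≅⇔Twist {Φ = Φ} {Ψ})
         (_ , FieldProperties.⁻¹-≉0 finiteField z≉0 , Converse.twist Φ Ψ J≈ sameFI isB z≉0 FI≈)
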